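{- The finite satisfiability problem of $\mathrm{FO}^2(+1_l, +1_p)$ is undecidable. That is, there is no algorithm which, given as input a sentence $\varphi$ of two-variable first-order logic over a vocabulary consisting of finitely many unary relation symbols and the two binary relation symbols $+1_l$ and $+1_p$, decides whether there exists a $(+1_l, +1_p)$-structure $\mathcal{A}$ (a finite structure with non-empty universe in which $+1_l$ is interpreted as the successor relation of some linear order on the universe, $+1_p$ is interpreted as the successor relation of some total preorder on the universe, and the unary relation symbols are interpreted arbitrarily) such that $\mathcal{A} \models \varphi$.
   Context: All sets and structures are finite, and structures have non-empty universe. Preorders and linear orders. A binary relation $\leq_p$ on a finite set $A$ is a (total) preorder if it is reflexive, transitive and total (for all $u,v\in A$, $u \leq_p v$ or $v \leq_p u$). A linear order $\leq_l$ on $A$ is an antisymmetric total preorder. Write $u <_p v$ if $u \leq_p v$ but not $v \leq_p u$, and similarly $u <_l v$ for a linear order. Successor relations. The successor relation $+1_l$ induced by a linear order $\leq_l$ is defined by: $+1_l(u,v)$ holds if and only if $u <_l v$ and there is no $w$ with $u <_l w <_l v$. The successor relation $+1_p$ induced by a total preorder $\leq_p$ is defined by: $+1_p(u,v)$ holds if and only if $u <_p v$ and there is no $w$ with $u <_p w <_p v$. (Thus an element may have several $+1_p$-successors.) Structures. A $(+1_l,+1_p)$-structure is a finite structure with non-empty universe $A$, some (finitely many) unary relations on $A$, a binary relation $+1_l$ that is the successor relation induced by some linear order on $A$, and a binary relation $+1_p$ that is the successor relation induced by some total preorder on $A$. The orders $\leq_l$ and $\leq_p$ themselves are not part of the vocabulary.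 Logic. Two-variable logic $\mathrm{FO}^2$ is the restriction of first-order logic (with equality, as usual) to formulas using at most two distinct variables $x$ and $y$ (which may be re-quantified). $\mathrm{FO}^2(+1_l,+1_p)$ denotes two-variable logic over vocabularies containing some unary relation symbols (arbitrarily but finitely many, depending on the formula) and the binary relation symbols $+1_l$ and $+1_p$, interpreted over $(+1_l,+1_p)$-structures. The finite satisfiability problem asks, given a sentence of this logic (suitably encoded as a finite string), whether it has a model among the $(+1_l,+1_p)$-structures. "Undecidable" means not decidable by any Turing machine. -}

module Defs where

open import Data.Fin.Base using (Fin; toℕ)
open import Data.List.Base using (List; []; _∷_; _++_; [_]; map; replicate)
open import Data.Nat.Base using (ℕ; zero; suc)
open import Data.Product.Base using (∃; ∃-syntax; _×_; _,_; proj₁)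
open import Data.Sum.Base using (_⊎_)
open import Function.Bundles using (_↔_; _⇔_)
open import Function.Definitions using (Injective)
open import Level using (0ℓ; _⊔_) renaming (suc to lsuc)
open import Relation.Binary.Core using (Rel)
import Relation.Binary.Definitions as Binary
open import Relation.Binary.PropositionalEquality.Core using (_≡_; _≢_)
open import Relation.Binary.Structures using (IsDecTotalOrder; IsTotalPreorder)
open import Relation.Nullary.Negation.Core using (¬_)
open import Relation.Unary using (Pred)
import Relation.Unary as Unary

Finite : Set → Set
Finite A = ∃[ n ] (A ↔ Fin n)

------------------------------------------------------------------------
-- Turing machines

-- Deterministic machines with one two-way infinite tape.

data Move : Set where
  left stay right : Move

data Control (Q : Set) : Set where
  running       : Q → Control Q
  accept reject : Control Q

record TuringMachine (Σ : Set) : Set₁ where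
  field
    State           : Set
    state-finite    : Finite State
    Symbol          : Set
    symbol-finite   : Finite Symbol
    blank           : Symbol
    input           : Σ → Symbol
    input-injective : Injective _≡_ _≡_ input
    input≢blank     : ∀ a → input a ≢ blank
    start           : Control State
    δ               : State → Symbol → Control State × Symbol × Move

  -- tape ls c rs: c is the scanned cell, ls and rs list the cells to its left
  -- and right, nearest cell first; all cells beyond the lists are blank.
  data Tape : Set where
    tape : List Symbol → Symbol → List Symbol → Tape

  Configuration : Set
  Configuration = Control State × Tape

  write : Symbol → Tape → Tape
  write c (tape ls _ rs) = tape ls c rs

  move : Move → Tape → Tape
  move left  (tape []       c rs)       = tape [] blank (c ∷ rs)
  move left  (tape (l ∷ ls) c rs)       = tape ls l (c ∷ rs)
  move stay  t                          = t
  move right (tape ls       c [])       = tape (c ∷ ls) blank []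
  move right (tape ls       c (r ∷ rs)) = tape (c ∷ ls) r rs

  scanned : Tape → Symbol
  scanned (tape _ c _) = c

  step : Configuration → Configuration
  step (running q , t) =
    let (q′ , c , m) = δ q (scanned t) in q′ , move m (write c t)
  step (accept    , t) = accept , t
  step (reject    , t) = reject , t

  run : ℕ → Configuration → Configuration
  run zero    c = c
  run (suc n) c = run n (step c)

  initialTape : List Σ → Tape
  initialTape []      = tape [] blank []
  initialTape (a ∷ w) = tape [] (input a) (map input w)

  HaltsAs : Control State → List Σ → Set
  HaltsAs q w = ∃[ n ] proj₁ (run n (start , initialTape w)) ≡ q

  Accepts Rejects : List Σ → Set
  Accepts = HaltsAs accept
  Rejects = HaltsAs reject

-- Only strings encoding an instance matter; the behaviour on all other
-- strings is unconstrained.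
Decides : ∀ {Σ I : Set} {ℓ} →
          TuringMachine Σ → (I → List Σ) → Pred I ℓ → Set ℓ
Decides M encode P =
  ∀ i → (Accepts (encode i) ⊎ Rejects (encode i)) × (Accepts (encode i) ⇔ P i)
  where open TuringMachine M

Undecidable : ∀ {Σ I : Set} {ℓ} → (I → List Σ) → Pred I ℓ → Set (lsuc 0ℓ ⊔ ℓ)
Undecidable {Σ} encode P = ¬ (∃[ M ] Decides {Σ} M encode P)

------------------------------------------------------------------------
-- (+1ˡ, +1ᵖ)-structures

Strict : ∀ {A : Set} → Rel A 0ℓ → Rel A 0ℓ
Strict _≤_ u v = u ≤ v × ¬ (v ≤ u)

Successor : ∀ {A : Set} → Rel A 0ℓ → Rel A 0ℓ
Successor _≤_ u v = u < v × ¬ (∃[ w ] (u < w × w < v))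
  where _<_ = Strict _≤_

record IsDecTotalPreorder {A : Set} (_≤_ : Rel A 0ℓ) : Set where
  field
    isTotalPreorder : IsTotalPreorder _≡_ _≤_
    _≤?_            : Binary.Decidable _≤_

-- Relations on the finite universe are decidable, so that the constructive
-- reading of the connectives in Satisfies below agrees with the classical one.
record Structure (k : ℕ) : Set₁ where
  field
    Universe : Set
    finite   : Finite Universe
    nonEmpty : Universe

    U  : Fin k → Pred Universe 0ℓ
    U? : ∀ i → Unary.Decidable (U i)

    _+1ˡ_     : Rel Universe 0ℓ
    +1ˡ-order : ∃ λ (_≤_ : Rel Universe 0ℓ) →
                IsDecTotalOrder _≡_ _≤_ ×
                (∀ u v → (u +1ˡ v) ⇔ Successor _≤_ u v)

    _+1ᵖ_        : Rel Universe 0ℓ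
    +1ᵖ-preorder : ∃ λ (_≤_ : Rel Universe 0ℓ) →
                   IsDecTotalPreorder _≤_ ×
                   (∀ u v → (u +1ᵖ v) ⇔ Successor _≤_ u v)

------------------------------------------------------------------------
-- Two-variable logic

data Var : Set where
  𝑥 𝑦 : Var

infix  9 _≐_
infix  8 ¬̇_
infixr 7 _∧̇_
infixr 6 _∨̇_
infixr 5 _⇒̇_

data Formula (k : ℕ) : Set where
  U̇              : Fin k → Var → Formula k
  _≐_ Ṡˡ Ṡᵖ      : Var → Var → Formula k
  ¬̇_             : Formula k → Formula k
  _∧̇_ _∨̇_ _⇒̇_    : Formula k → Formula k → Formula k
  ∃̇ ∀̇            : Var → Formula k → Formula k

Free : ∀ {k} → Var → Formula k → Set
Free z (U̇ i v)  = z ≡ v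
Free z (v ≐ w)  = z ≡ v ⊎ z ≡ w
Free z (Ṡˡ v w) = z ≡ v ⊎ z ≡ w
Free z (Ṡᵖ v w) = z ≡ v ⊎ z ≡ w
Free z (¬̇ φ)    = Free z φ
Free z (φ ∧̇ ψ)  = Free z φ ⊎ Free z ψ
Free z (φ ∨̇ ψ)  = Free z φ ⊎ Free z ψ
Free z (φ ⇒̇ ψ)  = Free z φ ⊎ Free z ψ
Free z (∃̇ v φ)  = z ≢ v × Free z φ
Free z (∀̇ v φ)  = z ≢ v × Free z φ

-- A sentence together with the number of unary symbols in its vocabulary.
record Sentence : Set where
  constructor sentence
  field
    {size}  : ℕ
    formula : Formula size
    closed  : ∀ z → ¬ Free z formula

module _ {k : ℕ} (𝒜 : Structure k) where
  open Structure 𝒜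

  Assignment : Set
  Assignment = Var → Universe

  _[_↦_] : Assignment → Var → Universe → Assignment
  (ρ [ 𝑥 ↦ a ]) 𝑥 = a
  (ρ [ 𝑥 ↦ a ]) 𝑦 = ρ 𝑦
  (ρ [ 𝑦 ↦ a ]) 𝑥 = ρ 𝑥
  (ρ [ 𝑦 ↦ a ]) 𝑦 = a

  Satisfies : Assignment → Formula k → Set
  Satisfies ρ (U̇ i v)  = U i (ρ v)
  Satisfies ρ (v ≐ w)  = ρ v ≡ ρ w
  Satisfies ρ (Ṡˡ v w) = ρ v +1ˡ ρ w
  Satisfies ρ (Ṡᵖ v w) = ρ v +1ᵖ ρ w
  Satisfies ρ (¬̇ φ)    = ¬ Satisfies ρ φ
  Satisfies ρ (φ ∧̇ ψ)  = Satisfies ρ φ × Satisfies ρ ψ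
  Satisfies ρ (φ ∨̇ ψ)  = Satisfies ρ φ ⊎ Satisfies ρ ψ
  Satisfies ρ (φ ⇒̇ ψ)  = Satisfies ρ φ → Satisfies ρ ψ
  Satisfies ρ (∃̇ v φ)  = ∃[ a ] Satisfies (ρ [ v ↦ a ]) φ
  Satisfies ρ (∀̇ v φ)  = ∀ a → Satisfies (ρ [ v ↦ a ]) φ

infix 4 _⊨_

-- For a closed formula the choice of assignment is immaterial.
_⊨_ : ∀ {k} → Structure k → Formula k → Set
𝒜 ⊨ φ = ∀ ρ → Satisfies 𝒜 ρ φ

FinitelySatisfiable : Pred Sentence (lsuc 0ℓ)
FinitelySatisfiable φ = ∃[ 𝒜 ] 𝒜 ⊨ Sentence.formula φ

------------------------------------------------------------------------
-- Sentences as strings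

data Letter : Set where
  `U `stroke `𝑥 `𝑦 `≐ `Sˡ `Sᵖ `¬ `∧ `∨ `⇒ `∃ `∀ : Letter

encodeVar : Var → Letter
encodeVar 𝑥 = `𝑥
encodeVar 𝑦 = `𝑦

unary : ℕ → List Letter
unary n = replicate n `stroke

-- Polish notation, hence uniquely readable without parentheses.
encodeFormula : ∀ {k} → Formula k → List Letter
encodeFormula (U̇ i v)  = `U ∷ unary (toℕ i) ++ [ encodeVar v ]
encodeFormula (v ≐ w)  = `≐ ∷ encodeVar v ∷ encodeVar w ∷ []
encodeFormula (Ṡˡ v w) = `Sˡ ∷ encodeVar v ∷ encodeVar w ∷ []
encodeFormula (Ṡᵖ v w) = `Sᵖ ∷ encodeVar v ∷ encodeVar w ∷ []
encodeFormula (¬̇ φ)    = `¬ ∷ encodeFormula φ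
encodeFormula (φ ∧̇ ψ)  = `∧ ∷ encodeFormula φ ++ encodeFormula ψ
encodeFormula (φ ∨̇ ψ)  = `∨ ∷ encodeFormula φ ++ encodeFormula ψ
encodeFormula (φ ⇒̇ ψ)  = `⇒ ∷ encodeFormula φ ++ encodeFormula ψ
encodeFormula (∃̇ v φ)  = `∃ ∷ encodeVar v ∷ encodeFormula φ
encodeFormula (∀̇ v φ)  = `∀ ∷ encodeVar v ∷ encodeFormula φ

-- The vocabulary size precedes the formula; no formula starts with a stroke.
encode : Sentence → List Letter
encode φ = unary (Sentence.size φ) ++ encodeFormula (Sentence.formula φ)

{-# OPTIONS --safe #-}

-- The classes of the preorder are the successive instants of a run of a machine
-- with four counters. The value of a counter is the number of elements (tokens) of a
-- certain kind in the class. The linear successor is required to map each class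
-- bijectively to the next, so that tokens persist, and in each step one token changes
-- its kind. That only one does is expressed by demanding that every token about to
-- change in one class is linked by the linear successor to every changed token of the
-- next: both sets are then singletons.
--
-- Instead of a reduction carried out by a Turing machine, suppose that M decides
-- satisfiability, and let the sentence φ N force the counter machine to start with N
-- in two of its counters, by a chain of N equal nested quantifier blocks. In Polish
-- notation the encoding of φ N is a fixed prefix, followed by N copies of a fixed
-- block and a fixed ending. Taking for N the number that represents the prefix as the
-- contents of a stack, the counter machine can write down the encoding of φ N, run M
-- on it, and end if M rejects. So φ N is satisfiable exactly if M rejects it.

module Submission where

open import Defs

open import Data.Bool.Base using (Bool; true; false; if_then_else_)
open import Data.Bool.Properties using () renaming (_≟_ to _≟ᵇ_)
open import Data.Empty using (⊥; ⊥-elim)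
open import Data.Fin.Base using (Fin; zero; suc; toℕ; fromℕ; fromℕ<; inject₁; opposite; join; splitAt; combine; remQuot)
open import Data.Fin.Properties using
  (2↔Bool; *↔×; splitAt-join; remQuot-combine; combine-injective; combine-monoˡ-<; toℕ-combine; <-cmp;
   toℕ-injective; toℕ<n; toℕ-fromℕ; toℕ-fromℕ<; opposite-prop; toℕ-inject₁) renaming (_≟_ to _≟ᶠ_)
open import Data.Fin.Induction using (spo-noetherian)
open import Data.List.Base as List using (List; []; _∷_; _++_; map; filter; allFin; downFrom; reverse)
open import Data.List.Membership.Propositional using (_∈_)
open import Data.List.Membership.Propositional.Properties
  using (∈-map⁺; ∈-map⁻; ∈-filter⁺; ∈-filter⁻; ∈-allFin; ∈-downFrom⁺; ∈-downFrom⁻)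
open import Data.List.Properties using (++-assoc; reverse-involutive; ʳ++-defn)
import Data.List.Relation.Unary.All as All
import Data.List.Relation.Unary.All.Properties as All
open import Data.List.Relation.Unary.AllPairs.Core as AllPairs using (_∷_)
open import Data.List.Relation.Unary.Any using (here; there)
open import Data.List.Relation.Unary.Unique.Propositional using (Unique)
import Data.List.Relation.Unary.Unique.Propositional.Properties as Unique
import Data.Maybe.Properties as Maybe
open import Data.Maybe.Base using (Maybe; just; nothing)
open import Data.Nat.Base using (ℕ; zero; suc; _+_; _*_; _∸_; _≤_; _<_; z≤n; s≤s)
import Data.Nat.Properties as ℕ
open import Data.Nat.Properties using
  (+-comm; +-assoc; +-identityʳ; suc-injective; m+n≡0⇒n≡0; _≤?_; _<?_; ≤-refl; ≤-trans; <⇒≤; <⇒≱; ≰⇒>)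
open import Data.Product.Base using (∃₂; ∃-syntax; _×_; _,_; proj₁; proj₂)
import Data.Product.Properties as Product
open import Data.Sum.Base using (_⊎_; inj₁; inj₂)
open import Data.Unit.Base using (⊤; tt)
open import Data.Vec.Base using (Vec; []; _∷_; lookup; _[_]≔_; _[_]%=_; replicate)
open import Data.Vec.Properties using (lookup-replicate; lookup∘updateAt; lookup∘updateAt′; lookup∘update; lookup∘update′)
open import Function.Base using (_∘_; id; case_of_)
open import Function.Bundles using (Inverse; Equivalence; mk⇔)
open import Function.Properties.Inverse using (↔-sym)
open import Induction.WellFounded using (WellFounded; Acc; acc)
open import Level using (0ℓ)
open import Relation.Binary.Core using (Rel)
open import Relation.Binary.Definitions using (DecidableEquality; tri<; tri≈; tri>)
open import Relation.Binary.Structures using (IsDecTotalOrder; IsTotalPreorder; IsStrictPartialOrder)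
open import Relation.Binary.PropositionalEquality
  using (_≡_; _≢_; refl; sym; trans; cong; cong₂; subst; subst₂; isEquivalence; module ≡-Reasoning)
open import Relation.Nullary using (¬_; Dec; yes; no; does; contradiction)
open import Relation.Nullary.Decidable using (_×-dec_; ¬?; map′; dec-true; dec-false)

-- Enumerations of finite types

record Enumeration (A : Set) : Set where
  constructor enumeration
  field
    {size}  : ℕ
    index   : A → Fin size
    element : Fin size → A
    -- The inverse is one-sided: `index` is an injection into a possibly larger `Fin size`, whose
    -- surplus indices merely repeat elements.
    element∘index : ∀ a → element (index a) ≡ a

  index-injective : ∀ {a b} → index a ≡ index b → a ≡ b
  index-injective {a} {b} eq =
    trans (sym (element∘index a)) (trans (cong element eq) (element∘index b))

  decide-≡ : DecidableEquality A
  decide-≡ a b = map′ index-injective (cong index) (index a ≟ᶠ index b)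

open Enumeration using (index; element; element∘index)

enum-Fin : ∀ {n} → Enumeration (Fin n)
enum-Fin = enumeration id id (λ _ → refl)

enum-Finite : ∀ {A} → Finite A → Enumeration A
enum-Finite (_ , i) = enumeration (Inverse.to i) (Inverse.from i) (λ _ → Inverse.inverseʳ i refl)

enum-Bool : Enumeration Bool
enum-Bool = enumeration (Inverse.from 2↔Bool) (Inverse.to 2↔Bool) (λ _ → Inverse.inverseˡ 2↔Bool refl)

enum-retract : ∀ {A B} (f : A → B) (g : B → A) → (∀ a → g (f a) ≡ a) → Enumeration B → Enumeration A
enum-retract f g g∘f (enumeration i e e∘i) =
  enumeration (i ∘ f) (g ∘ e) (λ a → trans (cong g (e∘i (f a))) (g∘f a))

enum-⊎ : ∀ {A B} → Enumeration A → Enumeration B → Enumeration (A ⊎ B)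
enum-⊎ {A} {B} (enumeration {m} i e e∘i) (enumeration {n} j f f∘j) = enumeration to from from∘to
  where
  to : A ⊎ B → Fin (m + n)
  to (inj₁ a) = join m n (inj₁ (i a))
  to (inj₂ b) = join m n (inj₂ (j b))
  from′ : Fin m ⊎ Fin n → A ⊎ B
  from′ (inj₁ k) = inj₁ (e k)
  from′ (inj₂ k) = inj₂ (f k)
  from : Fin (m + n) → A ⊎ B
  from k = from′ (splitAt m k)
  from∘to : ∀ x → from (to x) ≡ x
  from∘to (inj₁ a) rewrite splitAt-join m n (inj₁ (i a)) = cong inj₁ (e∘i a)
  from∘to (inj₂ b) rewrite splitAt-join m n (inj₂ (j b)) = cong inj₂ (f∘j b)

enum-× : ∀ {A B} → Enumeration A → Enumeration B → Enumeration (A × B)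
enum-× {A} {B} (enumeration {m} i e e∘i) (enumeration {n} j f f∘j) = enumeration to from from∘to
  where
  to : A × B → Fin (m * n)
  to (a , b) = combine (i a) (j b)
  from : Fin (m * n) → A × B
  from k = let (p , q) = remQuot n k in e p , f q
  from∘to : ∀ x → from (to x) ≡ x
  from∘to (a , b) = trans (cong (λ (p , q) → e p , f q) (remQuot-combine (i a) (j b)))
    (cong₂ _,_ (e∘i a) (f∘j b))

enum-Maybe : ∀ {A} → Enumeration A → Enumeration (Maybe A)
enum-Maybe {A} E = enum-retract to from from∘to (enum-⊎ (enum-Fin {1}) E)
  where
  to : Maybe A → Fin 1 ⊎ A
  to nothing  = inj₁ zero
  to (just a) = inj₂ a
  from : Fin 1 ⊎ A → Maybe A
  from (inj₁ _) = nothing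
  from (inj₂ a) = just a
  from∘to : ∀ a → from (to a) ≡ a
  from∘to nothing  = refl
  from∘to (just _) = refl

-- Counter machines

Counter : Set
Counter = Fin 4

Counts : Set
Counts = Vec ℕ 4

data Op (Q : Set) : Set where
  inc : Counter → Q → Q → Op Q
  jzd : Counter → Q → Q → Op Q

-- The value of the tested counter is a separate argument, so that proofs can split on it after
-- generalising `lookup v c`.
jump : ∀ {Q : Set} → Counter → Q → Q → Counts → ℕ → Q × Counts
jump c q₁ q₂ v zero    = q₁ , v
jump c q₁ q₂ v (suc n) = q₂ , v [ c ]≔ n

-- The Boolean resolves the nondeterministic choice of inc and is ignored by jzd
-- (jump if zero, else decrement).
perform : ∀ {Q} → Bool → Op Q → Counts → Q × Counts
perform b (inc c q₁ q₂) v = (if b then q₁ else q₂) , v [ c ]%= suc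
perform b (jzd c q₁ q₂) v = jump c q₁ q₂ v (lookup v c)

-- From here on the Boolean is, for jzd, whether the counter is zero.
next : ∀ {Q} → Bool → Op Q → Q
next b (inc c q₁ q₂) = if b then q₁ else q₂
next b (jzd c q₁ q₂) = if b then q₁ else q₂

-- Each unit of a counter is a token; the tokens not in use are of kind nothing.
Kind : Set
Kind = Maybe Counter

-- The zero branch moves a token from `nothing` to `nothing`, so that every step, without exception,
-- has one moving token.
source target : ∀ {Q} → Bool → Op Q → Kind
source b     (inc _ _ _) = nothing
source true  (jzd _ _ _) = nothing
source false (jzd c _ _) = just c
target b     (inc c _ _) = just c
target b     (jzd _ _ _) = nothing

-- The zero test as a condition on single tokens. It is imposed on the class after the step, which
-- is equivalent because the zero branch leaves all counters alone.
Guard : ∀ {Q} → Bool → Op Q → Kind → Set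
Guard true (jzd c _ _) κ = κ ≢ just c
Guard _    _           κ = ⊤

module Machine {Q : Set} (op : Q → Op Q) where

  Conf : Set
  Conf = Q × Counts

  step : Bool → Conf → Conf
  step b (q , v) = perform b (op q) v

  infix 4 _⟶[_]_
  data _⟶[_]_ (c : Conf) : ℕ → Conf → Set where
    done : c ⟶[ 0 ] c
    _◁_  : ∀ {n d} b → step b c ⟶[ n ] d → c ⟶[ suc n ] d

  -- Here the choices are given in advance as a function of time, for building a model; `_⟶[_]_`
  -- gathers choices found one by one in a given model.
  steps : (ℕ → Bool) → ℕ → Conf → Conf
  steps β zero    c = c
  steps β (suc n) c = step (β n) (steps β n c)

-- Counting tokens

_≟κ_ : DecidableEquality Kind
_≟κ_ = Maybe.≡-dec _≟ᶠ_

δ : Kind → Kind → ℕ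
δ κ λ′ = if does (κ ≟κ λ′) then 1 else 0

δ-refl : ∀ κ → δ κ κ ≡ 1
δ-refl κ with κ ≟κ κ
... | yes _ = refl
... | no ≢κ = contradiction refl ≢κ

δ-≢ : ∀ {κ λ′} → κ ≢ λ′ → δ κ λ′ ≡ 0
δ-≢ {κ} {λ′} ≢κ with κ ≟κ λ′
... | yes ≡κ = contradiction ≡κ ≢κ
... | no _   = refl

module Count {A : Set} where

  count : (A → Kind) → List A → Kind → ℕ
  count k []       κ = 0
  count k (x ∷ xs) κ = δ κ (k x) + count k xs κ

  count-map : ∀ {f : A → A} k xs κ → count k (map f xs) κ ≡ count (k ∘ f) xs κ
  count-map k []       κ = refl
  count-map {f} k (x ∷ xs) κ = cong (δ κ (k (f x)) +_) (count-map k xs κ)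

  count-cong : ∀ {k k′ : A → Kind} xs → (∀ {x} → x ∈ xs → k x ≡ k′ x) → ∀ κ → count k xs κ ≡ count k′ xs κ
  count-cong []       eq κ = refl
  count-cong (x ∷ xs) eq κ = cong₂ (λ l m → δ κ l + m) (eq (here refl)) (count-cong xs (eq ∘ there) κ)

  count-absent : ∀ {k : A → Kind} xs {κ} → (∀ {x} → x ∈ xs → k x ≢ κ) → count k xs κ ≡ 0
  count-absent []       ∉xs = refl
  count-absent (x ∷ xs) ∉xs rewrite δ-≢ (∉xs (here refl) ∘ sym) = count-absent xs (∉xs ∘ there)

  count-present : ∀ {k : A → Kind} xs {κ n} → count k xs κ ≡ suc n → ∃[ x ] x ∈ xs × k x ≡ κ
  count-present {k} (x ∷ xs) {κ} eq with κ ≟κ k x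
  ... | yes κ≡ = x , here refl , sym κ≡
  ... | no _   = let (y , y∈ , ky) = count-present xs eq in y , there y∈ , ky

  count-zero : ∀ {k : A → Kind} xs {κ} → count k xs κ ≡ 0 → ∀ {x} → x ∈ xs → k x ≢ κ
  count-zero {k} (x ∷ xs) eq (here refl) refl with k x ≟κ k x
  ... | no ≢κ = ≢κ refl
  count-zero {k} (x ∷ xs) {κ} eq (there y∈) = count-zero xs (m+n≡0⇒n≡0 (δ κ (k x)) eq) y∈

  -- Moving one token from kind k a to kind k′ a, with both sides moved so that
  -- no subtraction occurs.
  count-move : ∀ {k k′ : A → Kind} {a} {xs} → Unique xs → a ∈ xs →
               (∀ {x} → x ∈ xs → x ≢ a → k′ x ≡ k x) →
               ∀ κ → count k′ xs κ + δ κ (k a) ≡ count k xs κ + δ κ (k′ a)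
  count-move {k} {k′} {a} {a ∷ xs} (a∉ ∷ _) (here refl) same κ = begin
    δ κ (k′ a) + count k′ xs κ + δ κ (k a)
      ≡⟨ cong (λ n → δ κ (k′ a) + n + δ κ (k a)) (count-cong xs (λ x∈ → same (there x∈) (All.lookup a∉ x∈ ∘ sym)) κ) ⟩
    δ κ (k′ a) + count k xs κ + δ κ (k a)  ≡⟨ +-comm _ (δ κ (k a)) ⟩
    δ κ (k a) + (δ κ (k′ a) + count k xs κ) ≡⟨ cong (δ κ (k a) +_) (+-comm (δ κ (k′ a)) _) ⟩
    δ κ (k a) + (count k xs κ + δ κ (k′ a)) ≡⟨ +-assoc (δ κ (k a)) _ _ ⟨
    δ κ (k a) + count k xs κ + δ κ (k′ a) ∎
    where open ≡-Reasoning
  count-move {k} {k′} {a} {x ∷ xs} (x∉ ∷ uniq) (there a∈) same κ = begin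
    δ κ (k′ x) + count k′ xs κ + δ κ (k a)    ≡⟨ +-assoc (δ κ (k′ x)) _ _ ⟩
    δ κ (k′ x) + (count k′ xs κ + δ κ (k a))
      ≡⟨ cong₂ (λ l n → δ κ l + n) (same (here refl) (All.lookup x∉ a∈)) (count-move uniq a∈ (same ∘ there) κ) ⟩
    δ κ (k x) + (count k xs κ + δ κ (k′ a))   ≡⟨ +-assoc (δ κ (k x)) _ _ ⟨
    δ κ (k x) + count k xs κ + δ κ (k′ a)     ∎
    where open ≡-Reasoning

open Count

Absent : ∀ {Q} → Bool → Op Q → (Kind → ℕ) → Set
Absent true (jzd c _ _) n = n (just c) ≡ 0
Absent _    _           n = ⊤

just≢ : ∀ {c d : Counter} → c ≢ d → _≢_ {A = Kind} (just c) (just d)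
just≢ c≢d refl = c≢d refl

-- The link between tokens and counters, used in both directions of the reduction. On the
-- decrementing branch the equation at `just c` forces the counter to be positive; on the zero
-- branch `Absent` forces it to be zero.
perform-counts : ∀ {Q} (o : Op Q) b (v : Counts) {n n′ : Kind → ℕ} →
  (∀ c → lookup v c ≡ n (just c)) →
  (∀ κ → n′ κ + δ κ (source b o) ≡ n κ + δ κ (target b o)) →
  Absent b o n′ →
  proj₁ (perform b o v) ≡ next b o × (∀ c → lookup (proj₂ (perform b o v)) c ≡ n′ (just c))
perform-counts (inc c q₁ q₂) b v {n} {n′} v≡n eq _ = refl , counts
  where
  open ≡-Reasoning
  counts : ∀ d → lookup (v [ c ]%= suc) d ≡ n′ (just d)
  counts d with d ≟ᶠ c
  ... | yes refl = begin
    lookup (v [ c ]%= suc) c      ≡⟨ lookup∘updateAt c v ⟩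
    suc (lookup v c)              ≡⟨ +-comm 1 _ ⟩
    lookup v c + 1                ≡⟨ cong₂ _+_ (v≡n c) (sym (δ-refl (just c))) ⟩
    n (just c) + δ (just c) (just c) ≡⟨ eq (just c) ⟨
    n′ (just c) + 0               ≡⟨ +-identityʳ _ ⟩
    n′ (just c)                   ∎
  ... | no d≢c = begin
    lookup (v [ c ]%= suc) d      ≡⟨ lookup∘updateAt′ d c d≢c v ⟩
    lookup v d                    ≡⟨ trans (v≡n d) (sym (+-identityʳ _)) ⟩
    n (just d) + 0                ≡⟨ cong (n (just d) +_) (δ-≢ (just≢ d≢c)) ⟨
    n (just d) + δ (just d) (just c) ≡⟨ eq (just d) ⟨
    n′ (just d) + 0               ≡⟨ +-identityʳ _ ⟩
    n′ (just d)                   ∎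
perform-counts (jzd c q₁ q₂) true v {n} {n′} v≡n eq absent = go (lookup v c) (trans (v≡n c) (trans (n≡n′ c) absent))
  where
  n≡n′ : ∀ d → n (just d) ≡ n′ (just d)
  n≡n′ d = trans (sym (+-identityʳ _)) (trans (sym (eq (just d))) (+-identityʳ _))
  go : ∀ m → m ≡ 0 → proj₁ (jump c q₁ q₂ v m) ≡ q₁ × (∀ d → lookup (proj₂ (jump c q₁ q₂ v m)) d ≡ n′ (just d))
  go zero _ = refl , λ d → trans (v≡n d) (n≡n′ d)
perform-counts (jzd c q₁ q₂) false v {n} {n′} v≡n eq _ = go (lookup v c) (trans (v≡n c) n≡suc)
  where
  open ≡-Reasoning
  n≡suc : n (just c) ≡ suc (n′ (just c))
  n≡suc = begin
    n (just c)                         ≡⟨ +-identityʳ _ ⟨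
    n (just c) + 0                     ≡⟨ eq (just c) ⟨
    n′ (just c) + δ (just c) (just c)  ≡⟨ cong (n′ (just c) +_) (δ-refl (just c)) ⟩
    n′ (just c) + 1                    ≡⟨ +-comm _ 1 ⟩
    suc (n′ (just c))                  ∎
  go : ∀ m → m ≡ suc (n′ (just c)) →
       proj₁ (jump c q₁ q₂ v m) ≡ q₂ × (∀ d → lookup (proj₂ (jump c q₁ q₂ v m)) d ≡ n′ (just d))
  go (suc m) m≡ = refl , counts
    where
    counts : ∀ d → lookup (v [ c ]≔ m) d ≡ n′ (just d)
    counts d with d ≟ᶠ c
    ... | yes refl = trans (lookup∘update c v m) (suc-injective m≡)
    ... | no d≢c = begin
      lookup (v [ c ]≔ m) d  ≡⟨ lookup∘update′ d≢c v m ⟩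
      lookup v d             ≡⟨ v≡n d ⟩
      n (just d)             ≡⟨ +-identityʳ _ ⟨
      n (just d) + 0         ≡⟨ eq (just d) ⟨
      n′ (just d) + δ (just d) (just c) ≡⟨ cong (n′ (just d) +_) (δ-≢ (just≢ d≢c)) ⟩
      n′ (just d) + 0        ≡⟨ +-identityʳ _ ⟩
      n′ (just d)            ∎

-- Opaque because with-abstraction loses sight of the decision once it unfolds to _≡ᵇ_.
opaque
  _≟_ : DecidableEquality ℕ
  _≟_ = ℕ._≟_

update : (ℕ → Kind) → ℕ → Kind → ℕ → Kind
update f a κ i = if does (i ≟ a) then κ else f i

update-at : ∀ f a {κ} → update f a κ a ≡ κ
update-at f a with a ≟ a
... | yes _ = refl
... | no ≢a = contradiction refl ≢a

update-elsewhere : ∀ f {a κ i} → i ≢ a → update f a κ i ≡ f i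
update-elsewhere f {a} {κ} {i} i≢a with i ≟ a
... | yes i≡a = contradiction i≡a i≢a
... | no _    = refl

-- Turns an arbitrary choice into the bit recorded in the labels, which for `jzd` has to be the
-- outcome of the zero test.
effective : ∀ {Q} → Bool → Op Q → Counts → Bool
effective b (inc _ _ _) v = b
effective b (jzd c _ _) v with lookup v c
... | zero  = true
... | suc _ = false

effective-perform : ∀ {Q} b (o : Op Q) v → perform b o v ≡ perform (effective b o v) o v
effective-perform b (inc _ _ _) v = refl
effective-perform b (jzd c _ _) v = refl

-- Successors in total preorders

module Successors {A : Set} {_≲_ : Rel A 0ℓ} (isDTP : IsDecTotalPreorder _≲_) where
  open IsDecTotalPreorder isDTP renaming (_≤?_ to _≲?_) public
  open IsTotalPreorder isTotalPreorder using (total) renaming (trans to ≲-trans; refl to ≲-refl) public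

  infix 4 _~_ _⋖_ _≺_
  _~_ _≺_ _⋖_ : Rel A 0ℓ
  x ~ y = x ≲ y × y ≲ x
  _≺_ = Strict _≲_
  _⋖_ = Successor _≲_

  ~-sym : ∀ {x y} → x ~ y → y ~ x
  ~-sym (p , q) = q , p

  ≲-≺-trans : ∀ {x y z} → x ≲ y → y ≺ z → x ≺ z
  ≲-≺-trans p (q , r) = ≲-trans p q , λ s → r (≲-trans s p)

  ≺-≲-trans : ∀ {x y z} → x ≺ y → y ≲ z → x ≺ z
  ≺-≲-trans (p , r) q = ≲-trans p q , λ s → r (≲-trans q s)

  ⋖-respˡ : ∀ {x x′ y} → x ~ x′ → x ⋖ y → x′ ⋖ y
  ⋖-respˡ (x≲x′ , x′≲x) (x≺y , none) =
    ≲-≺-trans x′≲x x≺y , λ (w , x′≺w , w≺y) → none (w , ≲-≺-trans x≲x′ x′≺w , w≺y)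

  ⋖-respʳ : ∀ {x y y′} → y ~ y′ → x ⋖ y → x ⋖ y′
  ⋖-respʳ (y≲y′ , y′≲y) (x≺y , none) =
    ≺-≲-trans x≺y y≲y′ , λ (w , x≺w , w≺y′) → none (w , x≺w , ≺-≲-trans w≺y′ y′≲y)

  ⋖-injective : ∀ {x x′ y} → x ⋖ y → x′ ⋖ y → x ~ x′
  ⋖-injective {x} {x′} (x≺y , none) (x′≺y , none′) with x ≲? x′ | x′ ≲? x
  ... | yes p | yes q = p , q
  ... | yes p | no ¬q = contradiction (x′ , (p , ¬q) , x′≺y) none
  ... | no ¬p | yes q = contradiction (x , (q , ¬p) , x≺y) none′
  ... | no ¬p | no ¬q with total x x′
  ...   | inj₁ p = contradiction p ¬p
  ...   | inj₂ q = contradiction q ¬q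

  ⋖-functional : ∀ {x y y′} → x ⋖ y → x ⋖ y′ → y ~ y′
  ⋖-functional {x} {y} {y′} (x≺y , none) (x≺y′ , none′) with y ≲? y′ | y′ ≲? y
  ... | yes p | yes q = p , q
  ... | yes p | no ¬q = contradiction (y , x≺y , (p , ¬q)) none′
  ... | no ¬p | yes q = contradiction (y′ , x≺y′ , (q , ¬p)) none
  ... | no ¬p | no ¬q with total y y′
  ...   | inj₁ p = contradiction p ¬p
  ...   | inj₂ q = contradiction q ¬q

totalPreorder : ∀ {A : Set} {_≲_ : Rel A 0ℓ} → IsDecTotalOrder _≡_ _≲_ → IsDecTotalPreorder _≲_
totalPreorder order = record
  { isTotalPreorder = record { isPreorder = O.isPreorder ; total = O.total } ; _≤?_ = O._≤?_ }
  where module O = IsDecTotalOrder order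

-- Formulas

⋀ ⋁ : ∀ {k n} → (Fin n → Formula k) → Formula k
⋀ {n = zero}  φ = 𝑥 ≐ 𝑥
⋀ {n = suc n} φ = φ zero ∧̇ ⋀ (φ ∘ suc)
⋁ {n = zero}  φ = ¬̇ (𝑥 ≐ 𝑥)
⋁ {n = suc n} φ = φ zero ∨̇ ⋁ (φ ∘ suc)

module _ {k : ℕ} (𝒜 : Structure k) where

  ⋀-elim : ∀ {n ρ} (φ : Fin n → Formula k) → Satisfies 𝒜 ρ (⋀ φ) → ∀ i → Satisfies 𝒜 ρ (φ i)
  ⋀-elim φ (p , ps) zero    = p
  ⋀-elim φ (p , ps) (suc i) = ⋀-elim (φ ∘ suc) ps i

  ⋀-intro : ∀ {n ρ} (φ : Fin n → Formula k) → (∀ i → Satisfies 𝒜 ρ (φ i)) → Satisfies 𝒜 ρ (⋀ φ)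
  ⋀-intro {zero}  φ p = refl
  ⋀-intro {suc n} φ p = p zero , ⋀-intro (φ ∘ suc) (p ∘ suc)

  ⋁-elim : ∀ {n ρ} (φ : Fin n → Formula k) → Satisfies 𝒜 ρ (⋁ φ) → ∃[ i ] Satisfies 𝒜 ρ (φ i)
  ⋁-elim {zero}  φ p        = ⊥-elim (p refl)
  ⋁-elim {suc n} φ (inj₁ p) = zero , p
  ⋁-elim {suc n} φ (inj₂ p) = let (i , q) = ⋁-elim (φ ∘ suc) p in suc i , q

  ⋁-intro : ∀ {n ρ} (φ : Fin n → Formula k) i → Satisfies 𝒜 ρ (φ i) → Satisfies 𝒜 ρ (⋁ φ)
  ⋁-intro φ zero    p = inj₁ p
  ⋁-intro φ (suc i) p = inj₂ (⋁-intro (φ ∘ suc) i p)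

-- Labels and the sentence describing a run

record Label (Q : Set) : Set where
  constructor label
  field
    state   : Q
    kind    : Kind
    -- just b: the token that changes its kind in this step, b being the branch taken
    mark    : Maybe Bool
    -- whether the token changed its kind in the preceding step
    changed : Bool
open Label

enum-Label : ∀ {Q} → Enumeration Q → Enumeration (Label Q)
enum-Label EQ = enum-retract (λ l → state l , kind l , mark l , changed l)
  (λ (q , κ , m , c) → label q κ m c) (λ _ → refl)
  (enum-× EQ (enum-× (enum-Maybe enum-Fin) (enum-× (enum-Maybe enum-Bool) enum-Bool)))

-- One level of `nest`. Polish notation needs no closing letters, and two quantifiers lead from `𝑥`
-- back to `𝑥`, so that all levels read the same.
block : List Letter
block = `∃ ∷ `𝑦 ∷ `∧ ∷ `Sᵖ ∷ `𝑥 ∷ `𝑦 ∷ `∃ ∷ `𝑥 ∷ `∧ ∷ `Sᵖ ∷ `𝑦 ∷ `𝑥 ∷ []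

module Runs {Q : Set} (EQ : Enumeration Q) (EL : Enumeration (Label Q))
            (op : Q → Op Q) (init start final : Q) where
  open Machine op

  L : Set
  L = Label Q

  size : ℕ
  size = suc (Enumeration.size EL)

  has : Fin (Enumeration.size EL) → Var → Formula size
  has a = U̇ (suc a)

  -- As symbol number zero it is written without strokes, which keeps the ending after the last
  -- block down to two letters.
  isStart : Var → Formula size
  isStart = U̇ zero

  -- Labels are compared negatively, so that nothing depends on an element having only one.
  rel : (P : L → L → Set) → (∀ a b → Dec (P a b)) → Formula size
  rel P P? = ⋀ λ i → ⋀ λ j →
    if does (P? (element EL i) (element EL j)) then 𝑥 ≐ 𝑥 else ¬̇ (has i 𝑥 ∧̇ has j 𝑦)

  Active : L → Set
  Active a = mark a ≢ nothing

  active? : ∀ a → Dec (Active a)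
  active? a with mark a
  ... | nothing = no λ p → p refl
  ... | just _  = yes λ ()

  Active₂ : L → L → Set
  Active₂ a b = Active b

  active₂? : ∀ a b → Dec (Active₂ a b)
  active₂? a b = active? b

  _≟q_ : DecidableEquality Q
  _≟q_ = Enumeration.decide-≡ EQ

  guard? : ∀ b (o : Op Q) κ → Dec (Guard b o κ)
  guard? true  (jzd c _ _) κ = ¬? (κ ≟κ just c)
  guard? true  (inc _ _ _) κ = yes tt
  guard? false (jzd c _ _) κ = yes tt
  guard? false (inc _ _ _) κ = yes tt

  -- `Global′` is what a marked token dictates to the whole next class, `Local′` what a token
  -- dictates to itself one instant later. The mark is a separate argument so that proofs can
  -- generalise it.
  Global′ : Maybe Bool → L → L → Set
  Global′ nothing  a b = ⊤
  Global′ (just β) a b = state b ≡ next β (op (state a)) × Guard β (op (state a)) (kind b)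

  Local′ : Maybe Bool → L → L → Set
  Local′ nothing  a b = kind b ≡ kind a × changed b ≡ false
  Local′ (just β) a b = kind a ≡ source β (op (state a)) × kind b ≡ target β (op (state a)) × changed b ≡ true

  Global Local Elsewhere : L → L → Set
  Global a b = Global′ (mark a) a b
  Local  a b = Local′ (mark a) a b
  Elsewhere a b = ¬ (Active a × changed b ≡ true)

  global? : ∀ a b → Dec (Global a b)
  global? a b with mark a
  ... | nothing = yes tt
  ... | just β  = (_ ≟q _) ×-dec guard? β (op (state a)) (kind b)

  local? : ∀ a b → Dec (Local a b)
  local? a b with mark a
  ... | nothing = (_ ≟κ _) ×-dec (_ ≟ᵇ _)
  ... | just β  = (_ ≟κ _) ×-dec ((_ ≟κ _) ×-dec (_ ≟ᵇ _))

  elsewhere? : ∀ a b → Dec (Elsewhere a b)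
  elsewhere? a b = ¬? (active? a ×-dec (_ ≟ᵇ _))

  Start Final Initial : L → L → Set
  Start   a b = state a ≡ start
  Final   a b = state a ≡ final
  Initial a b = state a ≡ init × kind a ≡ nothing

  start? : ∀ a b → Dec (Start a b)
  start? a b = _ ≟q _

  final? : ∀ a b → Dec (Final a b)
  final? a b = _ ≟q _

  initial? : ∀ a b → Dec (Initial a b)
  initial? a b = (_ ≟q _) ×-dec (_ ≟κ _)

  -- Linear successors and predecessors are unique, so `forth` and `back` yield bijections between
  -- consecutive classes. `choice` provides a marked token before each later class. The last
  -- disjunction of `pairs` makes it unique: the successor of a marked token is changed, hence is
  -- the linear successor of every marked token.
  pairs forth back choice rules minimal : Formula size
  pairs =
    ⋁ (λ i → has i 𝑥) ∧̇
    (isStart 𝑥 ⇒̇ rel Start start?) ∧̇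
    (Ṡᵖ 𝑥 𝑦 ⇒̇ rel Global global? ∧̇ (Ṡˡ 𝑥 𝑦 ⇒̇ rel Local local?) ∧̇ (Ṡˡ 𝑥 𝑦 ∨̇ rel Elsewhere elsewhere?))
  forth = ∀̇ 𝑦 (¬̇ Ṡᵖ 𝑥 𝑦 ∧̇ rel Final final?) ∨̇ ∃̇ 𝑦 (Ṡᵖ 𝑥 𝑦 ∧̇ Ṡˡ 𝑥 𝑦)
  back  = ∀̇ 𝑦 (¬̇ Ṡᵖ 𝑦 𝑥 ∧̇ rel Initial initial?) ∨̇ ∃̇ 𝑦 (Ṡᵖ 𝑦 𝑥 ∧̇ Ṡˡ 𝑦 𝑥)
  choice = ∀̇ 𝑦 (¬̇ Ṡᵖ 𝑦 𝑥) ∨̇ ∃̇ 𝑦 (Ṡᵖ 𝑦 𝑥 ∧̇ rel Active₂ active₂?)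
  rules = ∀̇ 𝑥 (∀̇ 𝑦 pairs) ∧̇ ∀̇ 𝑥 forth ∧̇ ∀̇ 𝑥 back ∧̇ ∀̇ 𝑥 choice
  minimal = ∀̇ 𝑦 (¬̇ Ṡᵖ 𝑦 𝑥)

  -- Each level advances by two instants, the duration of one round of the loading loop in the
  -- counter machine below.
  nest : ℕ → Formula size
  nest zero    = isStart 𝑥
  nest (suc n) = ∃̇ 𝑦 (Ṡᵖ 𝑥 𝑦 ∧̇ ∃̇ 𝑥 (Ṡᵖ 𝑦 𝑥 ∧̇ nest n))

  startsAfter : ℕ → Formula size
  startsAfter n = rules ∧̇ ∃̇ 𝑥 (minimal ∧̇ nest n)

  nest-free : ∀ n {z} → Free z (nest n) → z ≡ 𝑥
  nest-free zero    p = p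
  nest-free (suc n) (z≢y , inj₁ (inj₁ z≡x)) = z≡x
  nest-free (suc n) (z≢y , inj₁ (inj₂ z≡y)) = contradiction z≡y z≢y
  nest-free (suc n) (z≢y , inj₂ (z≢x , inj₁ (inj₁ z≡y))) = contradiction z≡y z≢y
  nest-free (suc n) (z≢y , inj₂ (z≢x , inj₁ (inj₂ z≡x))) = z≡x
  nest-free (suc n) (z≢y , inj₂ (z≢x , inj₂ p)) = contradiction (nest-free n p) z≢x

  neither : ∀ {z : Var} → z ≢ 𝑥 → z ≢ 𝑦 → ⊥
  neither {𝑥} p q = p refl
  neither {𝑦} p q = q refl

  startsAfter-closed : ∀ n z → ¬ Free z (startsAfter n)
  startsAfter-closed n z (inj₁ (inj₁ (p , q , _))) = neither p q
  startsAfter-closed n z (inj₁ (inj₂ (inj₁ (p , inj₁ (q , _))))) = neither p q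
  startsAfter-closed n z (inj₁ (inj₂ (inj₁ (p , inj₂ (q , _))))) = neither p q
  startsAfter-closed n z (inj₁ (inj₂ (inj₂ (inj₁ (p , inj₁ (q , _)))))) = neither p q
  startsAfter-closed n z (inj₁ (inj₂ (inj₂ (inj₁ (p , inj₂ (q , _)))))) = neither p q
  startsAfter-closed n z (inj₁ (inj₂ (inj₂ (inj₂ (p , inj₁ (q , _)))))) = neither p q
  startsAfter-closed n z (inj₁ (inj₂ (inj₂ (inj₂ (p , inj₂ (q , _)))))) = neither p q
  startsAfter-closed n z (inj₂ (p , inj₁ (q , _))) = neither p q
  startsAfter-closed n z (inj₂ (p , inj₂ q)) = p (nest-free n q)

  φ : ℕ → Sentence
  φ n = sentence (startsAfter n) (startsAfter-closed n)

  prefix : List Letter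
  prefix = unary size ++ `∧ ∷ encodeFormula rules ++ `∃ ∷ `𝑥 ∷ `∧ ∷ encodeFormula minimal

  suffix : ℕ → List Letter
  suffix zero    = `U ∷ `𝑥 ∷ []
  suffix (suc n) = block ++ suffix n

  encode-nest : ∀ n → encodeFormula (nest n) ≡ suffix n
  encode-nest zero    = refl
  encode-nest (suc n) = cong (block ++_) (encode-nest n)

  encode-φ : ∀ n → encode (φ n) ≡ prefix ++ suffix n
  encode-φ n = begin
    unary size ++ `∧ ∷ encodeFormula rules ++ `∃ ∷ `𝑥 ∷ `∧ ∷ encodeFormula minimal ++ encodeFormula (nest n)
      ≡⟨ cong (λ w → unary size ++ `∧ ∷ encodeFormula rules ++ `∃ ∷ `𝑥 ∷ `∧ ∷ encodeFormula minimal ++ w) (encode-nest n) ⟩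
    unary size ++ `∧ ∷ encodeFormula rules ++ `∃ ∷ `𝑥 ∷ `∧ ∷ encodeFormula minimal ++ suffix n
      ≡⟨ cong (λ w → unary size ++ `∧ ∷ w) (++-assoc (encodeFormula rules) _ _) ⟨
    unary size ++ `∧ ∷ (encodeFormula rules ++ `∃ ∷ `𝑥 ∷ `∧ ∷ encodeFormula minimal) ++ suffix n
      ≡⟨ ++-assoc (unary size) _ _ ⟨
    prefix ++ suffix n ∎
    where open ≡-Reasoning

  -- From a model to a run

  module Soundness (𝒜 : Structure size) {N} (model : 𝒜 ⊨ startsAfter N) where
    open Structure 𝒜

    ρ₀ : Var → Universe
    ρ₀ _ = nonEmpty

    ρ₂ : Universe → Universe → Var → Universe
    ρ₂ x y = _[_↦_] 𝒜 (_[_↦_] 𝒜 ρ₀ 𝑥 x) 𝑦 y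

    hasLabel : ∀ x → ∃[ i ] U (suc i) x
    hasLabel x = ⋁-elim 𝒜 {ρ = ρ₂ x x} (λ i → has i 𝑥) (proj₁ (proj₁ (proj₁ (model ρ₀)) x x))

    lab : Universe → L
    lab x = element EL (proj₁ (hasLabel x))

    rel-elim : ∀ P (P? : ∀ a b → Dec (P a b)) ρ → Satisfies 𝒜 ρ (rel P P?) → P (lab (ρ 𝑥)) (lab (ρ 𝑦))
    rel-elim P P? ρ sat
      with P? (lab (ρ 𝑥)) (lab (ρ 𝑦))
         | ⋀-elim 𝒜 {ρ = ρ} _ (⋀-elim 𝒜 {ρ = ρ} _ sat (proj₁ (hasLabel (ρ 𝑥)))) (proj₁ (hasLabel (ρ 𝑦)))
    ... | yes p | _    = p
    ... | no _  | sat′ = contradiction (proj₂ (hasLabel (ρ 𝑥)) , proj₂ (hasLabel (ρ 𝑦))) sat′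

    start-state : ∀ x → U zero x → state (lab x) ≡ start
    start-state x p = rel-elim Start start? (ρ₂ x x) (proj₁ (proj₂ (proj₁ (proj₁ (model ρ₀)) x x)) p)

    global : ∀ x y → x +1ᵖ y → Global (lab x) (lab y)
    global x y p = rel-elim Global global? (ρ₂ x y) (proj₁ (proj₂ (proj₂ (proj₁ (proj₁ (model ρ₀)) x y)) p))

    local : ∀ x y → x +1ᵖ y → x +1ˡ y → Local (lab x) (lab y)
    local x y p q = rel-elim Local local? (ρ₂ x y) (proj₁ (proj₂ (proj₂ (proj₂ (proj₁ (proj₁ (model ρ₀)) x y)) p)) q)

    unique-active : ∀ x y → x +1ᵖ y → Active (lab x) → changed (lab y) ≡ true → x +1ˡ y
    unique-active x y p act chd with proj₂ (proj₂ (proj₂ (proj₂ (proj₁ (proj₁ (model ρ₀)) x y)) p))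
    ... | inj₁ q = q
    ... | inj₂ r = contradiction (act , chd) (rel-elim Elsewhere elsewhere? (ρ₂ x y) r)

    forth′ : ∀ x → (∀ y → ¬ x +1ᵖ y) × state (lab x) ≡ final ⊎ ∃[ y ] x +1ᵖ y × x +1ˡ y
    forth′ x with proj₁ (proj₂ (proj₁ (model ρ₀))) x
    ... | inj₁ p = inj₁ ((λ y → proj₁ (p y)) , rel-elim Final final? (ρ₂ x x) (proj₂ (p x)))
    ... | inj₂ p = inj₂ p

    back′ : ∀ y → (∀ x → ¬ x +1ᵖ y) × (state (lab y) ≡ init × kind (lab y) ≡ nothing) ⊎
                  ∃[ x ] x +1ᵖ y × x +1ˡ y
    back′ y with proj₁ (proj₂ (proj₂ (proj₁ (model ρ₀)))) y
    ... | inj₁ p = inj₁ ((λ x → proj₁ (p x)) , rel-elim Initial initial? (ρ₂ y y) (proj₂ (p y)))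
    ... | inj₂ p = inj₂ p

    active-before : ∀ {x y} → x +1ᵖ y → ∃[ a ] a +1ᵖ y × Active (lab a)
    active-before {x} {y} p with proj₂ (proj₂ (proj₂ (proj₁ (model ρ₀)))) y
    ... | inj₁ q             = contradiction p (q x)
    ... | inj₂ (a , q , act) = a , q , rel-elim Active₂ active₂? (ρ₂ y a) act

    open Successors (proj₁ (proj₂ +1ᵖ-preorder))
    private module ˡ = Successors (totalPreorder (proj₁ (proj₂ +1ˡ-order)))

    toᵖ : ∀ {x y} → x +1ᵖ y → x ⋖ y
    toᵖ = Equivalence.to (proj₂ (proj₂ +1ᵖ-preorder) _ _)

    fromᵖ : ∀ {x y} → x ⋖ y → x +1ᵖ y
    fromᵖ = Equivalence.from (proj₂ (proj₂ +1ᵖ-preorder) _ _)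

    toˡ : ∀ {x y} → x +1ˡ y → x ˡ.⋖ y
    toˡ = Equivalence.to (proj₂ (proj₂ +1ˡ-order) _ _)

    ˡ-antisym : ∀ {x y} → x ˡ.~ y → x ≡ y
    ˡ-antisym (p , q) = IsDecTotalOrder.antisym (proj₁ (proj₂ +1ˡ-order)) p q

    +1ˡ-injective : ∀ {x x′ y} → x +1ˡ y → x′ +1ˡ y → x ≡ x′
    +1ˡ-injective p q = ˡ-antisym (ˡ.⋖-injective (toˡ p) (toˡ q))

    +1ˡ-functional : ∀ {x y y′} → x +1ˡ y → x +1ˡ y′ → y ≡ y′
    +1ˡ-functional p q = ˡ-antisym (ˡ.⋖-functional (toˡ p) (toˡ q))

    -- The same token one instant later. In the last class, where there is none, the value `x` is a
    -- mere default.
    σ : Universe → Universe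
    σ x with forth′ x
    ... | inj₁ _       = x
    ... | inj₂ (y , _) = y

    σ-succ : ∀ {x y} → x +1ᵖ y → x +1ᵖ σ x × x +1ˡ σ x
    σ-succ {x} {y} p with forth′ x
    ... | inj₁ (q , _) = contradiction p (q y)
    ... | inj₂ (_ , q) = q

    κ : Universe → Kind
    κ x = kind (lab x)

    -- The invariant carried from class to class. The list has no repetitions, so that `count` gives
    -- true cardinalities.
    record Class (x : Universe) (c : Conf) : Set where
      field
        members  : List Universe
        sound    : ∀ {y} → y ∈ members → x ~ y
        complete : ∀ {y} → x ~ y → y ∈ members
        unique   : Unique members
        states   : ∀ {y} → x ~ y → state (lab y) ≡ proj₁ c
        counts   : ∀ d → lookup (proj₂ c) d ≡ count κ members (just d)

    module _ {x y : Universe} {c : Conf} (x⋖y : x +1ᵖ y) (class : Class x c) where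
      open Class class

      private
        after : ∀ {x′} → x ~ x′ → x′ +1ᵖ y
        after x~x′ = fromᵖ (⋖-respˡ x~x′ (toᵖ x⋖y))

        σ-after : ∀ {x′} → x ~ x′ → x′ +1ᵖ σ x′ × x′ +1ˡ σ x′
        σ-after x~x′ = σ-succ (after x~x′)

        σ-class : ∀ {x′} → x ~ x′ → y ~ σ x′
        σ-class x~x′ = ⋖-functional (toᵖ (after x~x′)) (toᵖ (proj₁ (σ-after x~x′)))

        a : Universe
        a = proj₁ (active-before x⋖y)

        a⋖y : a +1ᵖ y
        a⋖y = proj₁ (proj₂ (active-before x⋖y))

        x~a : x ~ a
        x~a = ⋖-injective (toᵖ x⋖y) (toᵖ a⋖y)

        σ-onto : ∀ {y′} → y ~ y′ → ∃[ x′ ] x ~ x′ × y′ ≡ σ x′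
        σ-onto {y′} y~y′ with back′ y′
        ... | inj₁ (none , _) = contradiction (fromᵖ (⋖-respʳ y~y′ (toᵖ x⋖y))) (none x)
        ... | inj₂ (x′ , x′⋖y′ , x′⋖ˡy′) =
          let x~x′ = ⋖-injective (⋖-respʳ y~y′ (toᵖ x⋖y)) (toᵖ x′⋖y′)
          in x′ , x~x′ , +1ˡ-functional x′⋖ˡy′ (proj₂ (σ-after x~x′))

        σ-unique : ∀ xs → (∀ {x′} → x′ ∈ xs → x ~ x′) → Unique xs → Unique (map σ xs)
        σ-unique []        _   _           = AllPairs.[]
        σ-unique (x₁ ∷ xs) cls (x₁∉ ∷ uniq) =
          All.map⁺ (All.tabulate λ {x₂} x₂∈ σ≡ → All.lookup x₁∉ x₂∈
            (+1ˡ-injective (proj₂ (σ-after (cls (here refl))))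
              (subst (x₂ +1ˡ_) (sym σ≡) (proj₂ (σ-after (cls (there x₂∈)))))))
          ∷ σ-unique xs (cls ∘ there) uniq

        local-σ : ∀ {x′} → x ~ x′ → Local (lab x′) (lab (σ x′))
        local-σ x~x′ = local _ _ (proj₁ (σ-after x~x′)) (proj₂ (σ-after x~x′))

        -- As `a` is marked and `σ x′` changed, `unique-active` makes `a` a linear predecessor of
        -- `σ x′`; so is `x′`.
        active-only : ∀ {x′} → x ~ x′ → Active (lab x′) → changed (lab (σ x′)) ≡ true → x′ ≡ a
        active-only {x′} x~x′ act chd = +1ˡ-injective (proj₂ (σ-after x~x′))
          (unique-active a (σ x′) (fromᵖ (⋖-respʳ (σ-class x~x′) (toᵖ a⋖y)))
            (proj₂ (proj₂ (active-before x⋖y))) chd)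

        idle-kind : ∀ {x′} → x ~ x′ → x′ ≢ a → κ (σ x′) ≡ κ x′
        idle-kind {x′} x~x′ x′≢a with mark (lab x′) in eq | local-σ x~x′
        ... | nothing | same , _    = same
        ... | just β  | _ , _ , chd =
          contradiction (active-only x~x′ (λ m → case trans (sym eq) m of λ ()) chd) x′≢a

        active-mark : ∃[ β ] mark (lab a) ≡ just β
        active-mark with mark (lab a) | proj₂ (proj₂ (active-before x⋖y))
        ... | nothing | act = contradiction refl act
        ... | just β  | _   = β , refl

      private
        β : Bool
        β = proj₁ active-mark

        o : Op Q
        o = op (proj₁ c)

        active-local : κ a ≡ source β o × κ (σ a) ≡ target β o
        active-local = go (mark (lab a)) (proj₂ active-mark) (local-σ x~a)
          where
          go : ∀ m → m ≡ just β → Local′ m (lab a) (lab (σ a)) → κ a ≡ source β o × κ (σ a) ≡ target β o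
          go _ refl (p , q , _) rewrite states x~a = p , q

        active-global : ∀ {y′} → y ~ y′ → state (lab y′) ≡ next β o × Guard β o (κ y′)
        active-global {y′} y~y′ = go (mark (lab a)) (proj₂ active-mark)
          (global a y′ (fromᵖ (⋖-respʳ y~y′ (toᵖ a⋖y))))
          where
          go : ∀ m → m ≡ just β → Global′ m (lab a) (lab y′) → state (lab y′) ≡ next β o × Guard β o (κ y′)
          go _ refl p rewrite states x~a = p

        σ-sound : ∀ {y′} → y′ ∈ map σ members → y ~ y′
        σ-sound y′∈ with ∈-map⁻ σ y′∈
        ... | _ , x′∈ , refl = σ-class (sound x′∈)

        absent : Absent β o (count κ (map σ members))
        absent = go β o (λ y′∈ → proj₂ (active-global (σ-sound y′∈)))
          where
          go : ∀ β o → (∀ {y′} → y′ ∈ map σ members → Guard β o (κ y′)) → Absent β o (count κ (map σ members))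
          go true  (jzd c _ _) guard = count-absent (map σ members) guard
          go true  (inc _ _ _) guard = tt
          go false (jzd _ _ _) guard = tt
          go false (inc _ _ _) guard = tt

        performed : proj₁ (step β c) ≡ next β o ×
                    (∀ d → lookup (proj₂ (step β c)) d ≡ count κ (map σ members) (just d))
        performed = perform-counts o β (proj₂ c) counts moved absent
          where
          moved : ∀ l → count κ (map σ members) l + δ l (source β o) ≡ count κ members l + δ l (target β o)
          moved l rewrite count-map {f = σ} κ members l | sym (proj₁ active-local) | sym (proj₂ active-local) =
            count-move unique (complete x~a) (λ x′∈ → idle-kind (sound x′∈)) l

      -- The next class is the image of this one under the bijection `σ`. By `idle-kind` only `a`
      -- changes its kind, so `count-move` and `perform-counts` turn its move into the machine step
      -- whose branch is written on `a`.
      advance : ∃[ β ] Class y (step β c)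
      advance = β , record
        { members  = map σ members
        ; sound    = σ-sound
        ; complete = λ y~y′ → let (x′ , x~x′ , y′≡) = σ-onto y~y′ in
                     subst (_∈ map σ members) (sym y′≡) (∈-map⁺ σ (complete x~x′))
        ; unique   = σ-unique members sound unique
        ; states   = λ y~y′ → trans (proj₁ (active-global y~y′)) (sym (proj₁ performed))
        ; counts   = proj₂ performed
        }

    private
      ι : Universe → Fin (proj₁ finite)
      ι = Inverse.to (proj₂ finite)

      ι⁻¹ : Fin (proj₁ finite) → Universe
      ι⁻¹ = Inverse.from (proj₂ finite)

      ι⁻¹∘ι : ∀ x → ι⁻¹ (ι x) ≡ x
      ι⁻¹∘ι _ = Inverse.inverseʳ (proj₂ finite) refl

      ι∘ι⁻¹ : ∀ i → ι (ι⁻¹ i) ≡ i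
      ι∘ι⁻¹ _ = Inverse.inverseˡ (proj₂ finite) refl

    universe : List Universe
    universe = map ι⁻¹ (allFin _)

    ∈-universe : ∀ x → x ∈ universe
    ∈-universe x = subst (_∈ universe) (ι⁻¹∘ι x) (∈-map⁺ ι⁻¹ (∈-allFin (ι x)))

    universe-unique : Unique universe
    universe-unique = Unique.map⁺
      (λ {i} {j} eq → trans (sym (ι∘ι⁻¹ i)) (trans (cong ι eq) (ι∘ι⁻¹ j)))
      (Unique.allFin⁺ _)

    module _ {x : Universe} (first : ∀ y → ¬ y +1ᵖ x) where

      private
        initial : ∀ {y} → x ~ y → state (lab y) ≡ init × kind (lab y) ≡ nothing
        initial {y} x~y with back′ y
        ... | inj₁ (_ , p)       = p
        ... | inj₂ (z , z⋖y , _) = contradiction (fromᵖ (⋖-respʳ (~-sym x~y) (toᵖ z⋖y))) (first z)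

        near? : ∀ y → Dec (x ~ y)
        near? y = (x ≲? y) ×-dec (y ≲? x)

        sound : ∀ {y} → y ∈ filter near? universe → x ~ y
        sound y∈ = proj₂ (∈-filter⁻ near? {xs = universe} y∈)

      -- Without a preceding class, `back′` must take its first alternative on the whole class, so
      -- no token is in use.
      initial-class : Class x (init , replicate 4 0)
      initial-class = record
        { members  = filter near? universe
        ; sound    = sound
        ; complete = ∈-filter⁺ near? (∈-universe _)
        ; unique   = Unique.filter⁺ near? universe-unique
        ; states   = proj₁ ∘ initial
        ; counts   = λ d → trans (lookup-replicate d 0) (sym (count-absent (filter near? universe)
            λ y∈ eq → case trans (sym (proj₂ (initial (sound y∈)))) eq of λ ()))
        }

    infix 4 _≻_
    _≻_ : Rel Universe 0ℓ
    y ≻ x = x ≺ y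

    -- A strict order on a finite set is noetherian; the statement for `Fin` is transported along
    -- `ι`. This lets `finish` climb from class to class until the last one.
    ≻-wellFounded : WellFounded _≻_
    ≻-wellFounded x = subst (Acc _≻_) (ι⁻¹∘ι x) (go (ι x) (spo-noetherian {_⊏_ = _⊏_} isSPO (ι x)))
      where
      _⊏_ : Rel (Fin (proj₁ finite)) 0ℓ
      i ⊏ j = ι⁻¹ i ≺ ι⁻¹ j
      isSPO : IsStrictPartialOrder _≡_ _⊏_
      isSPO = record
        { isEquivalence = isEquivalence
        ; irrefl        = λ { refl (p , ¬p) → ¬p p }
        ; trans         = λ (p , _) q → ≲-≺-trans p q
        ; <-resp-≈      = subst (_ ⊏_) , subst (_⊏ _)
        }
      go : ∀ i → Acc (λ j i → i ⊏ j) i → Acc _≻_ (ι⁻¹ i)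
      go i (acc rec) = acc λ {y} i≺y → subst (Acc _≻_) (ι⁻¹∘ι y)
        (go (ι y) (rec (subst (ι⁻¹ i ≺_) (sym (ι⁻¹∘ι y)) i≺y)))

    walk : ∀ n {ρ c} → Class (ρ 𝑥) c → Satisfies 𝒜 ρ (nest n) →
           ∃₂ λ x d → c ⟶[ n * 2 ] d × Class x d × proj₁ d ≡ start
    walk zero {ρ} {c} class p =
      ρ 𝑥 , c , done , class , trans (sym (Class.states class (≲-refl , ≲-refl))) (start-state (ρ 𝑥) p)
    walk (suc n) class (y , x⋖y , z , y⋖z , p) =
      let (b₁ , class₁) = advance x⋖y class
          (b₂ , class₂) = advance y⋖z class₁
          (x , d , path , r) = walk n class₂ p
      in x , d , b₁ ◁ (b₂ ◁ path) , r

    finish : ∀ {x c} → Acc _≻_ x → Class x c → ∃₂ λ n d → c ⟶[ n ] d × proj₁ d ≡ final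
    finish {x} {c} (acc rec) class with forth′ x
    ... | inj₁ (_ , last)    = 0 , c , done , trans (sym (Class.states class (≲-refl , ≲-refl))) last
    ... | inj₂ (y , x⋖y , _) =
      let (b , class′) = advance x⋖y class
          (n , d , path , q) = finish (rec (proj₁ (toᵖ x⋖y))) class′
      in suc n , d , b ◁ path , q

    run-exists : ∃₂ λ d e → (init , replicate 4 0) ⟶[ N * 2 ] d × proj₁ d ≡ start ×
                            ∃[ n ] d ⟶[ n ] e × proj₁ e ≡ final
    run-exists =
      let (x₀ , first , p) = proj₂ (model ρ₀)
          (x , d , path , class , q) = walk N {_[_↦_] 𝒜 ρ₀ 𝑥 x₀} (initial-class first) p
          (n , e , path′ , r) = finish (≻-wellFounded x) class
      in d , e , path , q , n , path′ , r

  -- From a run to a model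

  module Completeness (β : ℕ → Bool) (N T : ℕ) where

    conf : ℕ → Conf
    conf s = steps β s (init , replicate 4 0)

    q : ℕ → Q
    q s = proj₁ (conf s)

    v : ℕ → Counts
    v s = proj₂ (conf s)

    o : ℕ → Op Q
    o s = op (q s)

    bit : ℕ → Bool
    bit s = effective (β s) (o s) (v s)

    record Tokens (s : ℕ) : Set where
      field
        kinds  : ℕ → Kind
        fresh  : ∀ i → s ≤ i → kinds i ≡ nothing
        counts : ∀ c → lookup (v s) c ≡ count kinds (downFrom s) (just c)

      -- Token `s` joins the list because it may be the one to move; being of kind `nothing`, it
      -- does not affect the counters yet.
      counts′ : ∀ c → lookup (v s) c ≡ count kinds (downFrom (suc s)) (just c)
      counts′ c rewrite fresh s ≤-refl = counts c

      pick : ∃[ a ] a ≤ s × kinds a ≡ source (bit s) (o s)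
      pick = go (o s)
        where
        go : ∀ o → ∃[ a ] a ≤ s × kinds a ≡ source (effective (β s) o (v s)) o
        go (inc _ _ _) = s , ≤-refl , fresh s ≤-refl
        go (jzd c _ _) with lookup (v s) c in eq
        ... | zero  = s , ≤-refl , fresh s ≤-refl
        ... | suc _ = let (a , a∈ , ka) = count-present (downFrom s) (trans (sym (counts c)) eq)
                      in a , <⇒≤ (∈-downFrom⁻ a∈) , ka

      mover : ℕ
      mover = proj₁ pick

      kinds′ : ℕ → Kind
      kinds′ = update kinds mover (target (bit s) (o s))

      moved : ∀ l → count kinds′ (downFrom (suc s)) l + δ l (source (bit s) (o s)) ≡
                    count kinds (downFrom (suc s)) l + δ l (target (bit s) (o s))
      moved l = subst₂ (λ a b → count kinds′ (downFrom (suc s)) l + δ l a ≡ count kinds (downFrom (suc s)) l + δ l b)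
        (proj₂ (proj₂ pick)) (update-at kinds mover)
        (count-move (Unique.downFrom⁺ (suc s)) (∈-downFrom⁺ (s≤s (proj₁ (proj₂ pick))))
          (λ {i} _ → update-elsewhere kinds) l)

      absent : Absent (bit s) (o s) (count kinds′ (downFrom (suc s)))
      absent = go (o s) moved
        where
        go : ∀ o → (∀ l → count kinds′ (downFrom (suc s)) l + δ l (source (effective (β s) o (v s)) o) ≡
                          count kinds (downFrom (suc s)) l + δ l (target (effective (β s) o (v s)) o)) →
             Absent (effective (β s) o (v s)) o (count kinds′ (downFrom (suc s)))
        go (inc _ _ _) eq with β s
        ... | true  = tt
        ... | false = tt
        go (jzd c _ _) eq with lookup (v s) c in v≡
        ... | suc _ = tt
        -- Source and target are both `nothing` here, so the count of `just c` is still the zero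
        -- that was tested.
        ... | zero  = trans (sym (+-identityʳ _)) (trans (eq (just c))
                        (trans (+-identityʳ _) (trans (sym (counts′ c)) v≡)))

      performed : q (suc s) ≡ next (bit s) (o s) ×
                  (∀ c → lookup (v (suc s)) c ≡ count kinds′ (downFrom (suc s)) (just c))
      performed rewrite effective-perform (β s) (o s) (v s) =
        perform-counts (o s) (bit s) (v s) counts′ moved absent

      fresh′ : ∀ i → suc s ≤ i → kinds′ i ≡ nothing
      fresh′ i s<i = trans (update-elsewhere kinds λ { refl → <⇒≱ s<i (proj₁ (proj₂ pick)) }) (fresh i (<⇒≤ s<i))

      guarded : ∀ i → Guard (bit s) (o s) (kinds′ i)
      guarded i = go (bit s) (o s) absent
        where
        go : ∀ b o → Absent b o (count kinds′ (downFrom (suc s))) → Guard b o (kinds′ i)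
        go false (inc _ _ _) _ = tt
        go false (jzd _ _ _) _ = tt
        go true  (inc _ _ _) _ = tt
        go true  (jzd c _ _) none k≡ with i ≤? s
        ... | yes i≤s = count-zero (downFrom (suc s)) none (∈-downFrom⁺ (s≤s i≤s)) k≡
        ... | no  i≰s = case trans (sym k≡) (fresh′ i (≰⇒> i≰s)) of λ ()

    open Tokens

    tokens : ∀ s → Tokens s
    tokens zero    = record { kinds = λ _ → nothing ; fresh = λ _ _ → refl ; counts = λ c → lookup-replicate c 0 }
    tokens (suc s) = record { kinds = kinds′ (tokens s) ; fresh = fresh′ (tokens s) ; counts = proj₂ (performed (tokens s)) }

    markAt : ℕ → ℕ → Maybe Bool
    markAt s i = if does (i ≟ mover (tokens s)) then just (bit s) else nothing

    changedAt : ℕ → ℕ → Bool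
    changedAt zero    i = false
    changedAt (suc s) i = does (i ≟ mover (tokens s))

    labelAt : ℕ → ℕ → L
    labelAt s i = label (q s) (kinds (tokens s) i) (markAt s i) (changedAt s i)

    active-mover : ∀ s → Active (labelAt s (mover (tokens s)))
    active-mover s with mover (tokens s) ≟ mover (tokens s)
    ... | yes _ = λ ()
    ... | no ≢  = contradiction refl ≢

    active-only : ∀ {s i} → Active (labelAt s i) → i ≡ mover (tokens s)
    active-only {s} {i} act with i ≟ mover (tokens s)
    ... | yes ≡m = ≡m
    ... | no _   = contradiction refl act

    changed-only : ∀ {s i} → changedAt (suc s) i ≡ true → i ≡ mover (tokens s)
    changed-only {s} {i} chd with i ≟ mover (tokens s)
    ... | yes ≡m = ≡m

    globalAt : ∀ s i j → Global (labelAt s i) (labelAt (suc s) j)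
    globalAt s i j with i ≟ mover (tokens s)
    ... | yes _ = proj₁ (performed (tokens s)) , guarded (tokens s) j
    ... | no _  = tt

    localAt : ∀ s i → Local (labelAt s i) (labelAt (suc s) i)
    localAt s i with i ≟ mover (tokens s)
    ... | yes refl = proj₂ (proj₂ (pick (tokens s))) , refl , refl
    ... | no _     = refl , refl

    Point : Set
    Point = Fin (suc T) × Fin (suc T)

    -- `key` is lexicographic with the token first: the linear order runs through all instants of
    -- one token before the next token begins. `time` forgets the token, so that instants become the
    -- classes of the preorder.
    key time : Point → ℕ
    key (i , s) = toℕ (combine i s)
    time (i , s) = toℕ s

    _≤ˡ_ _≤ᵖ_ : Rel Point 0ℓ
    x ≤ˡ y = key x ≤ key y
    x ≤ᵖ y = time x ≤ time y

    labelOf : Point → L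
    labelOf (i , s) = labelAt (toℕ s) (toℕ i)

    key-injective : ∀ {x y} → key x ≡ key y → x ≡ y
    key-injective {i , s} {j , t} eq with combine-injective i s j t (toℕ-injective eq)
    ... | refl , refl = refl

    𝒜 : Structure size
    𝒜 = record
      { Universe = Point
      ; finite   = _ , ↔-sym *↔×
      ; nonEmpty = zero , zero
      ; U  = λ { zero (_ , s) → q (toℕ s) ≡ start ; (suc a) x → a ≡ index EL (labelOf x) }
      ; U? = λ { zero (_ , s) → q (toℕ s) ≟q start ; (suc a) x → a ≟ᶠ index EL (labelOf x) }
      ; _+1ˡ_ = Successor _≤ˡ_
      ; +1ˡ-order = _≤ˡ_ , isDecTotalOrder , λ _ _ → mk⇔ id id
      ; _+1ᵖ_ = Successor _≤ᵖ_
      ; +1ᵖ-preorder = _≤ᵖ_ , isDecTotalPreorder , λ _ _ → mk⇔ id id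
      }
      where
      isDecTotalOrder : IsDecTotalOrder _≡_ _≤ˡ_
      isDecTotalOrder = record
        { isTotalOrder = record
          { isPartialOrder = record
            { isPreorder = record
              { isEquivalence = isEquivalence
              ; reflexive     = ℕ.≤-reflexive ∘ cong key
              ; trans         = ≤-trans
              }
            ; antisym = λ p q → key-injective (ℕ.≤-antisym p q)
            }
          ; total = λ x y → ℕ.≤-total (key x) (key y)
          }
        ; _≟_  = Product.≡-dec _≟ᶠ_ _≟ᶠ_
        ; _≤?_ = λ x y → key x ≤? key y
        }
      isDecTotalPreorder : IsDecTotalPreorder _≤ᵖ_
      isDecTotalPreorder = record
        { isTotalPreorder = record
          { isPreorder = record
            { isEquivalence = isEquivalence
            ; reflexive     = ℕ.≤-reflexive ∘ cong time
            ; trans         = ≤-trans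
            }
          ; total = λ x y → ℕ.≤-total (time x) (time y)
          }
        ; _≤?_ = λ x y → time x ≤? time y
        }

    at : ∀ {s} → s ≤ T → Fin (suc T)
    at s≤T = fromℕ< (s≤s s≤T)

    toℕ-at : ∀ {s} (s≤T : s ≤ T) → toℕ (at s≤T) ≡ s
    toℕ-at s≤T = toℕ-fromℕ< (s≤s s≤T)

    successorᵖ-time : ∀ x y → Successor _≤ᵖ_ x y → time y ≡ suc (time x)
    successorᵖ-time x y ((_ , t≰s) , none) with time y ≤? suc (time x)
    ... | yes t≤1+s = ℕ.≤-antisym t≤1+s (≰⇒> t≰s)
    ... | no  t≰1+s = contradiction (z , (<⇒≤ s<z , <⇒≱ s<z) , (<⇒≤ z<t , <⇒≱ z<t)) none
      where
      1+s≤T : suc (time x) ≤ T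
      1+s≤T = ≤-trans (<⇒≤ (≰⇒> t≰1+s)) (ℕ.≤-pred (toℕ<n (proj₂ y)))
      z : Point
      -- Every instant up to `T` is inhabited, by token zero for example, so no instant can be
      -- skipped.
      z = zero , at 1+s≤T
      s<z : time x < time z
      s<z = ℕ.≤-reflexive (sym (toℕ-at 1+s≤T))
      z<t : time z < time y
      z<t = subst (_< time y) (sym (toℕ-at 1+s≤T)) (≰⇒> t≰1+s)

    successorᵖ : ∀ x y → time y ≡ suc (time x) → Successor _≤ᵖ_ x y
    successorᵖ x y eq = (<⇒≤ s<t , <⇒≱ s<t) , λ (w , (_ , w≰s) , (_ , t≰w)) →
      <⇒≱ (≰⇒> t≰w) (subst (_≤ time w) (sym eq) (≰⇒> w≰s))
      where
      s<t : time x < time y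
      s<t = ℕ.≤-reflexive (sym eq)

    key-suc : ∀ {i s t} → toℕ t ≡ suc (toℕ s) → key (i , t) ≡ suc (key (i , s))
    key-suc {i} {s} {t} eq = begin
      toℕ (combine i t)                  ≡⟨ toℕ-combine i t ⟩
      suc T * toℕ i + toℕ t              ≡⟨ cong (suc T * toℕ i +_) eq ⟩
      suc T * toℕ i + suc (toℕ s)        ≡⟨ ℕ.+-suc (suc T * toℕ i) (toℕ s) ⟩
      suc (suc T * toℕ i + toℕ s)        ≡⟨ cong suc (toℕ-combine i s) ⟨
      suc (toℕ (combine i s))            ∎
      where open ≡-Reasoning

    successorˡ : ∀ {i s t} → toℕ t ≡ suc (toℕ s) → Successor _≤ˡ_ (i , s) (i , t)
    successorˡ {i} {s} {t} eq = (<⇒≤ x<y , <⇒≱ x<y) , λ (w , (_ , w≰x) , (_ , y≰w)) →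
      <⇒≱ (≰⇒> y≰w) (subst (_≤ key w) (sym (key-suc {i} {s} {t} eq)) (≰⇒> w≰x))
      where
      x<y : key (i , s) < key (i , t)
      x<y = ℕ.≤-reflexive (sym (key-suc {i} {s} {t} eq))

    -- If `i` were below `j`, the point `(i , t)` would lie strictly between the two; if above, the
    -- lexicographic order would be violated.
    successorˡ-id : ∀ {i j s t} → toℕ t ≡ suc (toℕ s) → Successor _≤ˡ_ (i , s) (j , t) → i ≡ j
    successorˡ-id {i} {j} {s} {t} eq ((_ , y≰x) , none) with <-cmp i j
    ... | tri≈ _ i≡j _ = i≡j
    ... | tri> _ _ j<i = contradiction (<⇒≤ (combine-monoˡ-< t s j<i)) y≰x
    ... | tri< i<j _ _ = contradiction
      ((i , t) , proj₁ (successorˡ {i} {s} {t} eq) , (<⇒≤ below , <⇒≱ below)) none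
      where
      below : key (i , t) < key (j , t)
      below = combine-monoˡ-< t t i<j

    rel-intro : ∀ P (P? : ∀ a b → Dec (P a b)) ρ → P (labelOf (ρ 𝑥)) (labelOf (ρ 𝑦)) → Satisfies 𝒜 ρ (rel P P?)
    rel-intro P P? ρ p = ⋀-intro 𝒜 {ρ = ρ} _ λ i → ⋀-intro 𝒜 {ρ = ρ} _ λ j → atom i j
      where
      atom : ∀ i j → Satisfies 𝒜 ρ (if does (P? (element EL i) (element EL j)) then 𝑥 ≐ 𝑥 else ¬̇ (has i 𝑥 ∧̇ has j 𝑦))
      atom i j with P? (element EL i) (element EL j)
      ... | yes _ = refl
      ... | no ¬p = λ { (refl , refl) → ¬p (subst₂ P (sym (element∘index EL _)) (sym (element∘index EL _)) p) }

    module _ (N*2≤T : N * 2 ≤ T) (started : q (N * 2) ≡ start) (finished : q T ≡ final) (ρ₀ : Var → Point) where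

      ρ₁ : Point → Var → Point
      ρ₁ = _[_↦_] 𝒜 ρ₀ 𝑥

      ρ₂ : Point → Point → Var → Point
      ρ₂ x = _[_↦_] 𝒜 (ρ₁ x) 𝑦

      mover≤ : ∀ s → mover (tokens s) ≤ s
      mover≤ s = proj₁ (proj₂ (pick (tokens s)))

      global : ∀ x y → time y ≡ suc (time x) → Global (labelOf x) (labelOf y)
      global (i , s) (j , t) eq rewrite eq = globalAt (toℕ s) (toℕ i) (toℕ j)

      local : ∀ x y → time y ≡ suc (time x) → Successor _≤ˡ_ x y → Local (labelOf x) (labelOf y)
      local (i , s) (j , t) eq x⋖y with successorˡ-id {i} {j} {s} {t} eq x⋖y
      ... | refl rewrite eq = localAt (toℕ s) (toℕ i)

      elsewhere : ∀ x y → time y ≡ suc (time x) → proj₁ x ≢ proj₁ y → Elsewhere (labelOf x) (labelOf y)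
      elsewhere (i , s) (j , t) eq i≢j (act , chd) rewrite eq =
        i≢j (toℕ-injective (trans (active-only {toℕ s} act) (sym (changed-only {toℕ s} chd))))

      sat-pairs : ∀ x y → Satisfies 𝒜 (ρ₂ x y) pairs
      sat-pairs x@(i , s) y@(j , t) =
        ⋁-intro 𝒜 {ρ = ρ₂ x y} (λ a → has a 𝑥) (index EL (labelOf x)) refl ,
        rel-intro Start start? (ρ₂ x y) ,
        λ x⋖y → let eq = successorᵖ-time x y x⋖y in
          rel-intro Global global? (ρ₂ x y) (global x y eq) ,
          (λ x⋖ˡy → rel-intro Local local? (ρ₂ x y) (local x y eq x⋖ˡy)) ,
          separate eq
        where
        separate : toℕ t ≡ suc (toℕ s) → Satisfies 𝒜 (ρ₂ x y) (Ṡˡ 𝑥 𝑦 ∨̇ rel Elsewhere elsewhere?)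
        separate eq with i ≟ᶠ j
        ... | yes refl = inj₁ (successorˡ {i} {s} {t} eq)
        ... | no i≢j   = inj₂ (rel-intro Elsewhere elsewhere? (ρ₂ x y) (elsewhere x y eq i≢j))

      sat-forth : ∀ x → Satisfies 𝒜 (ρ₁ x) forth
      sat-forth x@(i , s) with toℕ s <? T
      ... | yes s<T = inj₂ ((i , at s<T) , successorᵖ x (i , at s<T) (toℕ-at s<T) , successorˡ {i} {s} {at s<T} (toℕ-at s<T))
      ... | no  s≮T = inj₁ λ y →
        (λ x⋖y → s≮T (ℕ.≤-pred (subst (_≤ suc T) (cong suc (successorᵖ-time x y x⋖y)) (toℕ<n (proj₂ y))))) ,
        rel-intro Final final? (ρ₂ x y)
          (subst (λ s → q s ≡ final) (ℕ.≤-antisym (ℕ.≮⇒≥ s≮T) (ℕ.≤-pred (toℕ<n s))) finished)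

      sat-back : ∀ x → Satisfies 𝒜 (ρ₁ x) back
      sat-back x@(i , zero) = inj₁ λ y →
        (λ y⋖x → case successorᵖ-time y x y⋖x of λ ()) , rel-intro Initial initial? (ρ₂ x y) (refl , refl)
      sat-back x@(i , suc s) = inj₂ ((i , inject₁ s) , successorᵖ (i , inject₁ s) x eq , successorˡ {i} {inject₁ s} {suc s} eq)
        where
        eq : suc (toℕ s) ≡ suc (toℕ (inject₁ s))
        eq = cong suc (sym (toℕ-inject₁ s))

      sat-choice : ∀ x → Satisfies 𝒜 (ρ₁ x) choice
      sat-choice x@(i , zero) = inj₁ λ y y⋖x → case successorᵖ-time y x y⋖x of λ ()
      sat-choice x@(i , suc s) = inj₂ (a , successorᵖ a x (cong suc (sym (toℕ-inject₁ s))) ,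
        rel-intro Active₂ active₂? (ρ₂ x a) active)
        where
        m≤T : mover (tokens (toℕ s)) ≤ T
        m≤T = ≤-trans (mover≤ (toℕ s)) (<⇒≤ (toℕ<n s))
        a : Point
        a = at m≤T , inject₁ s
        active : Active (labelOf a)
        active rewrite toℕ-inject₁ s | toℕ-at m≤T = active-mover (toℕ s)

      -- Token zero witnesses all the quantifiers. The invariant says that the remaining levels, two
      -- instants each, end exactly at `N * 2`.
      sat-nest : ∀ n s (s≤T : s ≤ T) → n * 2 + s ≡ N * 2 → ∀ ρ → time (ρ 𝑥) ≡ s → Satisfies 𝒜 ρ (nest n)
      sat-nest zero s s≤T eq ρ time≡ = subst (λ s → q s ≡ start) (sym (trans time≡ eq)) started
      sat-nest (suc n) s s≤T eq ρ time≡ =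
        (zero , at 1+s≤T) , successorᵖ (ρ 𝑥) (zero , at 1+s≤T) (trans (toℕ-at 1+s≤T) (cong suc (sym time≡))) ,
        (zero , at 2+s≤T) , successorᵖ (zero , at 1+s≤T) (zero , at 2+s≤T) (trans (toℕ-at 2+s≤T) (cong suc (sym (toℕ-at 1+s≤T)))) ,
        sat-nest n (2 + s) 2+s≤T eq′ _ (toℕ-at 2+s≤T)
        where
        eq′ : n * 2 + (2 + s) ≡ N * 2
        eq′ = trans (trans (ℕ.+-suc (n * 2) (suc s)) (cong suc (ℕ.+-suc (n * 2) s))) eq
        2+s≤T : 2 + s ≤ T
        2+s≤T = ≤-trans (ℕ.m≤n+m (2 + s) (n * 2)) (≤-trans (ℕ.≤-reflexive eq′) N*2≤T)
        1+s≤T : 1 + s ≤ T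
        1+s≤T = <⇒≤ 2+s≤T

      satisfied : Satisfies 𝒜 ρ₀ (startsAfter N)
      satisfied = (sat-pairs , sat-forth , sat-back , sat-choice) ,
        (zero , zero) , (λ y y⋖x → case successorᵖ-time y (zero , zero) y⋖x of λ ()) ,
        sat-nest N 0 z≤n (+-identityʳ _) _ refl

-- Programs on two stacks

data Side : Set where
  leftˢ rightˢ : Side

data Instr (d : ℕ) (S : Set) : Set where
  push  : Side → Fin d → S → Instr d S
  pop   : Side → (Fin d → S) → Instr d S
  drain : S → S → Instr d S
  halt  : Instr d S

-- A stack of digits is kept in a counter as a number in base suc m, top digit
-- least significant. Counter 2 is decremented by drain, and counter 3 is
-- auxiliary: push and pop first empty the stack into it (collect, carry) and
-- then multiply or divide by suc m on the way back (spread).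
module Compile {m : ℕ} {S : Set} (instr : S → Instr (suc m) S) (entry : S) where

  base : ℕ
  base = suc m

  -- In `spread i` a push still owes the stack `i` increments before it takes the next unit of
  -- `aux`; a pop has taken `base` minus `i` units of `aux` since the quotient last grew.
  data Phase : Set where
    collect carry : Phase
    spread        : Fin (suc base) → Phase

  data Q : Set where
    load₁ load₂ start : Q
    at                : S → Phase → Q

  pattern countdown = suc (suc zero)
  pattern aux       = suc (suc (suc zero))

  counter : Side → Counter
  counter leftˢ  = zero
  counter rightˢ = suc zero

  compile : S → Instr base S → Phase → Op Q
  -- Entering the phase at `d` instead of at `base` adds the new digit first.
  compile s (push X d s′) collect          = jzd (counter X) (at s (spread (inject₁ d))) (at s carry)
  compile s (push X d s′) carry            = inc aux (at s collect) (at s collect)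
  compile s (push X d s′) (spread zero)    = jzd aux (at s′ collect) (at s (spread (fromℕ base)))
  compile s (push X d s′) (spread (suc i)) = inc (counter X) (at s (spread (inject₁ i))) (at s (spread (inject₁ i)))
  compile s (pop X k)     collect          = jzd (counter X) (at s (spread (fromℕ base))) (at s carry)
  compile s (pop X k)     carry            = inc aux (at s collect) (at s collect)
  compile s (pop X k)     (spread zero)    = inc (counter X) (at s (spread (fromℕ base))) (at s (spread (fromℕ base)))
  -- When `aux` runs out here, `m` minus `i` units of an incomplete group have been taken: the
  -- remainder, which is the popped digit.
  compile s (pop X k)     (spread (suc i)) = jzd aux (at (k (opposite i)) collect) (at s (spread (inject₁ i)))
  compile s (drain s₁ s₂) _                = jzd countdown (at s₁ collect) (at s₂ collect)
  -- A halted program counts on in `aux` forever, so its state persists at all later times.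
  compile s halt          p                = inc aux (at s p) (at s p)

  -- The only real choice is when to leave the loop of `load₁` and `load₂`, which raises counters 0
  -- and 2 together. The state `start` is passed at most once, so prescribing its instant prescribes
  -- the number of rounds.
  op : Q → Op Q
  op load₁    = inc zero load₂ load₂
  op load₂    = inc countdown load₁ start
  op start    = jzd aux (at entry collect) (at entry collect)
  op (at s p) = compile s (instr s) p

  open Machine op

  enum-Q : Enumeration S → Enumeration Q
  enum-Q ES = enum-retract to from from∘to
    (enum-⊎ (enum-Fin {3}) (enum-× ES (enum-⊎ enum-Bool enum-Fin)))
    where
    to : Q → Fin 3 ⊎ (S × (Bool ⊎ Fin (suc base)))
    to load₁             = inj₁ zero
    to load₂             = inj₁ (suc zero)
    to start             = inj₁ (suc (suc zero))
    to (at s collect)    = inj₂ (s , inj₁ false)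
    to (at s carry)      = inj₂ (s , inj₁ true)
    to (at s (spread i)) = inj₂ (s , inj₂ i)
    from : Fin 3 ⊎ (S × (Bool ⊎ Fin (suc base))) → Q
    from (inj₁ zero)             = load₁
    from (inj₁ (suc zero))       = load₂
    from (inj₁ (suc (suc zero))) = start
    from (inj₂ (s , inj₁ false)) = at s collect
    from (inj₂ (s , inj₁ true))  = at s carry
    from (inj₂ (s , inj₂ i))     = at s (spread i)
    from∘to : ∀ x → from (to x) ≡ x
    from∘to load₁             = refl
    from∘to load₂             = refl
    from∘to start             = refl
    from∘to (at s collect)    = refl
    from∘to (at s carry)      = refl
    from∘to (at s (spread i)) = refl

  -- Correctness of the compiled instructions

  iterate : ℕ → Conf → Conf
  iterate zero    c = c
  iterate (suc n) c = iterate n (step false c)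

  iterate-suc : ∀ n c → iterate (suc n) c ≡ step false (iterate n c)
  iterate-suc zero    c = refl
  iterate-suc (suc n) c = iterate-suc n (step false c)

  iterate-+ : ∀ n k c → iterate (n + k) c ≡ iterate k (iterate n c)
  iterate-+ zero    k c = refl
  iterate-+ (suc n) k c = iterate-+ n k (step false c)

  infix  4 _⇒_
  infixr 5 _►_
  _⇒_ : Conf → Conf → Set
  c ⇒ d = ∃[ n ] iterate n c ≡ d

  ⇒-refl : ∀ {c} → c ⇒ c
  ⇒-refl = 0 , refl

  ⇒-reflexive : ∀ {c d} → c ≡ d → c ⇒ d
  ⇒-reflexive eq = 0 , eq

  _►_ : ∀ {c d e} → c ⇒ d → d ⇒ e → c ⇒ e
  _►_ {c} (n , refl) (k , refl) = n + k , iterate-+ n k c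

  execute : ∀ {s I p v c} → instr s ≡ I → perform false (compile s I p) v ≡ c → (at s p , v) ⇒ c
  execute refl eq = 1 , eq

  -- The counter of the given side comes first and that of the other side second, so that both sides
  -- are treated at once.
  store : Side → ℕ → ℕ → ℕ → ℕ → Counts
  store leftˢ  x y k w = x ∷ y ∷ k ∷ w ∷ []
  store rightˢ x y k w = y ∷ x ∷ k ∷ w ∷ []

  jzd-zero : ∀ {q₁ q₂ : Q} X {y k w} → perform false (jzd (counter X) q₁ q₂) (store X 0 y k w) ≡ (q₁ , store X 0 y k w)
  jzd-zero leftˢ  = refl
  jzd-zero rightˢ = refl

  jzd-suc : ∀ {q₁ q₂ : Q} X {x y k w} →
            perform false (jzd (counter X) q₁ q₂) (store X (suc x) y k w) ≡ (q₂ , store X x y k w)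
  jzd-suc leftˢ  = refl
  jzd-suc rightˢ = refl

  inc-side : ∀ {q : Q} X {x y k w} →
             perform false (inc (counter X) q q) (store X x y k w) ≡ (q , store X (suc x) y k w)
  inc-side leftˢ  = refl
  inc-side rightˢ = refl

  jzd-aux-zero : ∀ {q₁ q₂ : Q} X {x y k} → perform false (jzd aux q₁ q₂) (store X x y k 0) ≡ (q₁ , store X x y k 0)
  jzd-aux-zero leftˢ  = refl
  jzd-aux-zero rightˢ = refl

  jzd-aux-suc : ∀ {q₁ q₂ : Q} X {x y k w} →
                perform false (jzd aux q₁ q₂) (store X x y k (suc w)) ≡ (q₂ , store X x y k w)
  jzd-aux-suc leftˢ  = refl
  jzd-aux-suc rightˢ = refl

  inc-aux : ∀ {q : Q} X {x y k w} → perform false (inc aux q q) (store X x y k w) ≡ (q , store X x y k (suc w))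
  inc-aux leftˢ  = refl
  inc-aux rightˢ = refl

  module _ {s X d s′} (is : instr s ≡ push X d s′) {y k : ℕ} where

    push-collect : ∀ x w → (at s collect , store X x y k w) ⇒ (at s (spread (inject₁ d)) , store X 0 y k (x + w))
    push-collect zero    w = execute is (jzd-zero X)
    push-collect (suc x) w = execute is (jzd-suc X) ► execute is (inc-aux X) ► push-collect x (suc w)
                             ► ⇒-reflexive (cong (λ w → at s (spread (inject₁ d)) , store X 0 y k w) (ℕ.+-suc x w))

    push-add : ∀ n {i : Fin (suc base)} {x w} → toℕ i ≡ n →
               (at s (spread i) , store X x y k w) ⇒ (at s (spread zero) , store X (n + x) y k w)
    push-add zero    {zero}          eq = ⇒-refl
    push-add (suc n) {suc i} {x} {w} eq =
      execute is (inc-side X) ► push-add n (trans (toℕ-inject₁ i) (suc-injective eq))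
      ► ⇒-reflexive (cong (λ x → at s (spread zero) , store X x y k w) (ℕ.+-suc n x))

    push-spread : ∀ w {x} → (at s (spread zero) , store X x y k w) ⇒ (at s′ collect , store X (x + w * base) y k 0)
    push-spread zero    {x} = execute is (jzd-aux-zero X)
                              ► ⇒-reflexive (cong (λ x → at s′ collect , store X x y k 0) (sym (+-identityʳ x)))
    push-spread (suc w) {x} = execute is (jzd-aux-suc X) ► push-add base (toℕ-fromℕ base) ► push-spread w
                              ► ⇒-reflexive (cong (λ x → at s′ collect , store X x y k 0)
                                  (trans (cong (_+ w * base) (+-comm base x)) (+-assoc x base (w * base))))

    push-run : ∀ {x} → (at s collect , store X x y k 0) ⇒ (at s′ collect , store X (toℕ d + x * base) y k 0)
    push-run {x} = push-collect x 0 ► push-add (toℕ d) (toℕ-inject₁ d) ► push-spread (x + 0)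
      ► ⇒-reflexive (cong (λ x → at s′ collect , store X x y k 0)
          (cong₂ (λ d x → d + x * base) (+-identityʳ (toℕ d)) (+-identityʳ x)))

  module _ {s X c} (is : instr s ≡ pop X c) {y k : ℕ} where

    pop-collect : ∀ x w → (at s collect , store X x y k w) ⇒ (at s (spread (fromℕ base)) , store X 0 y k (x + w))
    pop-collect zero    w = execute is (jzd-zero X)
    pop-collect (suc x) w = execute is (jzd-suc X) ► execute is (inc-aux X) ► pop-collect x (suc w)
                            ► ⇒-reflexive (cong (λ w → at s (spread (fromℕ base)) , store X 0 y k w) (ℕ.+-suc x w))

    pop-subtract : ∀ n {i : Fin base} {x w} → toℕ i ≡ n →
                   (at s (spread (suc i)) , store X x y k (suc n + w)) ⇒ (at s (spread zero) , store X x y k w)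
    pop-subtract zero    {zero}  eq = execute is (jzd-aux-suc X)
    pop-subtract (suc n) {suc i} eq =
      execute is (jzd-aux-suc X) ► pop-subtract n (trans (toℕ-inject₁ i) (suc-injective eq))

    -- Here `r` is what is left in `aux`. It decreases together with `i`, so the sum stays fixed,
    -- and at `r` zero the digit `d` is `m` minus `i`, that is, `opposite i`.
    pop-remainder : ∀ r {i d : Fin base} {x} → toℕ d + toℕ i ≡ r + m →
                    (at s (spread (suc i)) , store X x y k r) ⇒ (at (c d) collect , store X x y k 0)
    pop-remainder zero {i} {d} {x} eq = execute is (jzd-aux-zero X)
      ► ⇒-reflexive (cong (λ d → at (c d) collect , store X x y k 0) (toℕ-injective
          (trans (opposite-prop i) (trans (cong (_∸ toℕ i) (sym eq)) (ℕ.m+n∸n≡m (toℕ d) (toℕ i))))))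
    -- A whole group would still be available, making `d` exceed `m`.
    pop-remainder (suc r) {zero} {d} eq =
      contradiction (ℕ.≤-pred (toℕ<n d))
        (<⇒≱ (subst (m <_) (trans (sym eq) (+-identityʳ (toℕ d))) (s≤s (ℕ.m≤n+m m r))))
    pop-remainder (suc r) {suc i} {d} eq = execute is (jzd-aux-suc X)
      ► pop-remainder r (trans (cong (toℕ d +_) (toℕ-inject₁ i))
          (suc-injective (trans (sym (ℕ.+-suc (toℕ d) (toℕ i))) eq)))

    pop-spread : ∀ q d {x} → (at s (spread (fromℕ base)) , store X x y k (toℕ d + q * base)) ⇒
                             (at (c d) collect , store X (q + x) y k 0)
    pop-spread zero d {x} =
      ⇒-reflexive (cong (λ w → at s (spread (fromℕ base)) , store X x y k w) (+-identityʳ (toℕ d)))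
      ► pop-remainder (toℕ d) (cong (toℕ d +_) (toℕ-fromℕ m))
    pop-spread (suc q) d {x} =
      ⇒-reflexive (cong (λ w → at s (spread (fromℕ base)) , store X x y k w) regroup)
      ► pop-subtract m (toℕ-fromℕ m) ► execute is (inc-side X) ► pop-spread q d
      ► ⇒-reflexive (cong (λ x → at (c d) collect , store X x y k 0) (ℕ.+-suc q x))
      where
      regroup : toℕ d + (base + q * base) ≡ base + (toℕ d + q * base)
      regroup = trans (sym (+-assoc (toℕ d) base _)) (trans (cong (_+ q * base) (+-comm (toℕ d) base)) (+-assoc base (toℕ d) _))

    pop-run : ∀ d {x} → (at s collect , store X (toℕ d + x * base) y k 0) ⇒ (at (c d) collect , store X x y k 0)
    pop-run d {x} = pop-collect (toℕ d + x * base) 0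
      ► ⇒-reflexive (cong (λ w → at s (spread (fromℕ base)) , store X 0 y k w) (+-identityʳ _))
      ► pop-spread x d ► ⇒-reflexive (cong (λ x → at (c d) collect , store X x y k 0) (+-identityʳ x))

  -- Determinism after loading

  data Late : Q → Set where
    start : Late start
    at    : ∀ {s p} → Late (at s p)

  -- The second component keeps control among the states `at s p`, out of the loading loop and away
  -- from `start`.
  Determined : Op Q → Set
  Determined o = (∀ b v → perform b o v ≡ perform false o v) × (∀ v → ∃₂ λ s p → proj₁ (perform false o v) ≡ at s p)

  inc-determined : ∀ {c s p} → Determined (inc c (at s p) (at s p))
  inc-determined = (λ { false _ → refl ; true _ → refl }) , λ _ → _ , _ , refl

  jzd-determined : ∀ {c s₁ p₁ s₂ p₂} → Determined (jzd c (at s₁ p₁) (at s₂ p₂))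
  jzd-determined {c} = (λ _ _ → refl) , λ v → at-jump v (lookup v c)
    where
    at-jump : ∀ {c s₁ p₁ s₂ p₂} v n → ∃₂ λ s p → proj₁ (jump c (at s₁ p₁) (at s₂ p₂) v n) ≡ at s p
    at-jump v zero    = _ , _ , refl
    at-jump v (suc n) = _ , _ , refl

  compile-determined : ∀ s I p → Determined (compile s I p)
  compile-determined s (push X d s′) collect          = jzd-determined
  compile-determined s (push X d s′) carry            = inc-determined
  compile-determined s (push X d s′) (spread zero)    = jzd-determined
  compile-determined s (push X d s′) (spread (suc i)) = inc-determined
  compile-determined s (pop X c)     collect          = jzd-determined
  compile-determined s (pop X c)     carry            = inc-determined
  compile-determined s (pop X c)     (spread zero)    = inc-determined
  compile-determined s (pop X c)     (spread (suc i)) = jzd-determined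
  compile-determined s (drain s₁ s₂) _                = jzd-determined
  compile-determined s halt          p                = inc-determined

  op-determined : ∀ {q} → Late q → Determined (op q)
  op-determined start        = jzd-determined
  op-determined (at {s} {p}) = compile-determined s (instr s) p

  step-determined : ∀ c → Late (proj₁ c) → ∀ b → step b c ≡ step false c
  step-determined (_ , v) late b = proj₁ (op-determined late) b v

  step-at : ∀ c → Late (proj₁ c) → ∃₂ λ s p → proj₁ (step false c) ≡ at s p
  step-at (_ , v) late = proj₂ (op-determined late) v

  step-late : ∀ c → Late (proj₁ c) → Late (proj₁ (step false c))
  step-late c late with step-at c late
  ... | _ , _ , eq = subst Late (sym eq) at

  iterate-late : ∀ n c → Late (proj₁ c) → Late (proj₁ (iterate n c))
  iterate-late zero    c late = late
  iterate-late (suc n) c late = iterate-late n (step false c) (step-late c late)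

  path-determined : ∀ {n} c {d} → Late (proj₁ c) → c ⟶[ n ] d → d ≡ iterate n c
  path-determined c late done       = refl
  path-determined c late (b ◁ path) =
    path-determined (step false c) (step-late c late) (subst (_⟶[ _ ] _) (step-determined c late b) path)

  steps-determined : ∀ {β} n {k c} → Late (proj₁ (steps β k c)) → steps β (n + k) c ≡ iterate n (steps β k c)
  steps-determined zero    late = refl
  steps-determined {β} (suc n) {k} {c} late = begin
    step (β (n + k)) (steps β (n + k) c)          ≡⟨ cong (step (β (n + k))) (steps-determined n late) ⟩
    step (β (n + k)) (iterate n (steps β k c))    ≡⟨ step-determined _ (iterate-late n _ late) _ ⟩
    step false (iterate n (steps β k c))          ≡⟨ iterate-suc n (steps β k c) ⟨
    iterate (suc n) (steps β k c)                 ∎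
    where open ≡-Reasoning

  never-restarts : ∀ n c → Late (proj₁ c) → proj₁ (iterate (suc n) c) ≢ start
  never-restarts n c late eq with step-at (iterate n c) (iterate-late n c late)
  ... | _ , _ , eq′ = case trans (sym eq) (trans (cong proj₁ (iterate-suc n c)) eq′) of λ ()

  -- The loading loop

  loaded : ℕ → Counts
  loaded n = n ∷ 0 ∷ n ∷ 0 ∷ []

  -- A run that leaves the loop too early passes `start` too early, and by `never-restarts` it is
  -- not in `start` again at the prescribed time.
  load-sound : ∀ n j {d} → (load₁ , loaded j) ⟶[ n * 2 ] d → proj₁ d ≡ start → d ≡ (start , loaded (n + j))
  load-sound zero    j done ()
  load-sound (suc n) j (b ◁ path) eq = go b path eq
    where
    rest : ∀ n {d} b → step b (load₂ , suc j ∷ 0 ∷ j ∷ 0 ∷ []) ⟶[ n * 2 ] d → proj₁ d ≡ start →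
           d ≡ (start , loaded (suc n + j))
    rest n true path eq = trans (load-sound n (suc j) path eq) (cong (λ k → start , loaded k) (ℕ.+-suc n j))
    rest zero    false done       eq = refl
    rest (suc n) false path       eq =
      contradiction (trans (cong proj₁ (sym (path-determined (start , loaded (suc j)) start path))) eq) (never-restarts (suc (n * 2)) (start , loaded (suc j)) start)
    go : ∀ b {d} → step b (load₁ , loaded j) ⟶[ suc (n * 2) ] d → proj₁ d ≡ start → d ≡ (start , loaded (suc n + j))
    go true  (b′ ◁ path) = rest n b′ path
    go false (b′ ◁ path) = rest n b′ path

  module _ (n : ℕ) where

    -- The decision to leave falls in the second step of the last of `suc n` rounds, at time
    -- `suc (n * 2)`.
    branches : ℕ → Bool
    branches s = does (s <? suc (n * 2))

    load-twice : ∀ b {b₁ b₂} j → b₁ ≡ b₂ →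
                 step b₁ (step b (load₁ , loaded j)) ≡ ((if b₂ then load₁ else start) , loaded (suc j))
    load-twice false j refl = refl
    load-twice true  j refl = refl

    load-steps : ∀ j → j ≤ n → steps branches (j * 2) (load₁ , loaded 0) ≡ (load₁ , loaded j)
    load-steps zero    _   = refl
    load-steps (suc j) j<n =
      trans (cong (λ c → step (branches (suc (j * 2))) (step (branches (j * 2)) c)) (load-steps j (<⇒≤ j<n)))
        (load-twice (branches (j * 2)) j (dec-true (suc (j * 2) <? suc (n * 2)) (s≤s (ℕ.*-monoˡ-< 2 j<n))))

    load-complete : steps branches (suc n * 2) (load₁ , loaded 0) ≡ (start , loaded (suc n))
    load-complete =
      trans (cong (λ c → step (branches (suc (n * 2))) (step (branches (n * 2)) c)) (load-steps n ≤-refl))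
        (load-twice (branches (n * 2)) n (dec-false (suc (n * 2) <? suc (n * 2)) (ℕ.<-irrefl refl)))

  halted : ∀ {s} n {c} → instr s ≡ halt → proj₁ c ≡ at s collect → proj₁ (iterate n c) ≡ at s collect
  halted zero    is eq = eq
  halted (suc n) {c} is refl = halted n is (cong (λ I → proj₁ (perform false (compile _ I collect) (proj₂ c))) is)

-- The machine run on the encoding of a sentence about that run

module Simulation (M : TuringMachine Letter) where
  open TuringMachine M hiding (step; start) renaming (δ to δᴹ)

  ES : Enumeration State
  ES = enum-Finite state-finite

  EY : Enumeration Symbol
  EY = enum-Finite symbol-finite

  base : ℕ
  base = suc (Enumeration.size EY)

  Digit : Set
  Digit = Fin base

  -- The digit of the blank is zero, so that a stack extended by blanks is the same number.
  digit : Symbol → Digit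
  digit a with Enumeration.decide-≡ EY a blank
  ... | yes _ = zero
  ... | no _  = suc (index EY a)

  symbol : Digit → Symbol
  symbol zero    = blank
  symbol (suc i) = element EY i

  symbol∘digit : ∀ a → symbol (digit a) ≡ a
  symbol∘digit a with Enumeration.decide-≡ EY a blank
  ... | yes a≡blank = sym a≡blank
  ... | no _        = element∘index EY a

  digit-blank : digit blank ≡ zero
  digit-blank with Enumeration.decide-≡ EY blank blank
  ... | yes _ = refl
  ... | no ≢  = contradiction refl ≢

  digit-input : ∀ a → digit (input a) ≡ suc (index EY (input a))
  digit-input a with Enumeration.decide-≡ EY (input a) blank
  ... | yes ≡blank = contradiction ≡blank (input≢blank a)
  ... | no _       = refl

  number : List Symbol → ℕ
  number []       = 0
  number (a ∷ as) = toℕ (digit a) + number as * base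

  -- The input of `M` is pushed on the right stack from its end: the two closing letters by `post₁`
  -- and `post₂`, the blocks by `loop`, the prefix by `rewind` from the left stack. The simulation
  -- begins at `head`; a move to the left first pushes the written symbol, then transfers one more
  -- symbol by `fetch` and `put`.
  data S : Set where
    post₁ post₂ loop rewind : S
    block-letter            : Fin 12 → S
    rewind-put              : Digit → S
    head                    : Control State → S
    overwrite               : State → Digit → S
    fetch                   : Control State → S
    put                     : Control State → Digit → S

  next-letter : Fin 12 → S
  next-letter zero    = loop
  next-letter (suc i) = block-letter (inject₁ i)

  -- Digit zero, the blank, reveals the bottom of the left stack, since input letters are never
  -- blank.
  rewound : Digit → S
  rewound zero    = head (TuringMachine.start M)
  rewound (suc i) = rewind-put (suc i)

  act : Control State × Symbol × Move → Instr base S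
  act (q , a , left)  = push rightˢ (digit a) (fetch q)
  act (q , a , stay)  = push rightˢ (digit a) (head q)
  act (q , a , right) = push leftˢ  (digit a) (head q)

  -- The right stack starts with the scanned symbol.
  instr : S → Instr base S
  instr post₁             = push rightˢ (digit (input `𝑥)) post₂
  instr post₂             = push rightˢ (digit (input `U)) loop
  -- Index 11 is the last of the twelve letters of `block`; they are pushed in reverse order.
  instr loop              = drain rewind (block-letter (fromℕ 11))
  instr (block-letter i)  = push rightˢ (digit (input (List.lookup block i))) (next-letter i)
  instr rewind            = pop leftˢ rewound
  instr (rewind-put d)    = push rightˢ d rewind
  instr (head (running q)) = pop rightˢ (overwrite q)
  instr (head accept)     = halt
  instr (head reject)     = halt
  instr (overwrite q d)   = act (δᴹ q (symbol d))
  instr (fetch q)         = pop leftˢ (put q)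
  instr (put q d)         = push rightˢ d (head q)

  enum-Control : Enumeration (Control State)
  enum-Control = enum-retract to from from∘to (enum-⊎ enum-Bool ES)
    where
    to : Control State → Bool ⊎ State
    to (running q) = inj₂ q
    to accept      = inj₁ true
    to reject      = inj₁ false
    from : Bool ⊎ State → Control State
    from (inj₂ q)     = running q
    from (inj₁ true)  = accept
    from (inj₁ false) = reject
    from∘to : ∀ q → from (to q) ≡ q
    from∘to (running _) = refl
    from∘to accept      = refl
    from∘to reject      = refl

  enum-S : Enumeration S
  enum-S = enum-retract to from from∘to
    (enum-⊎ (enum-Fin {4}) (enum-⊎ enum-Fin (enum-⊎ enum-Fin (enum-⊎ enum-Control
      (enum-⊎ (enum-× ES enum-Fin) (enum-⊎ enum-Control (enum-× enum-Control enum-Fin)))))))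
    where
    Sum : Set
    Sum = Fin 4 ⊎ Fin 12 ⊎ Digit ⊎ Control State ⊎ (State × Digit) ⊎ Control State ⊎ (Control State × Digit)
    to : S → Sum
    to post₁            = inj₁ zero
    to post₂            = inj₁ (suc zero)
    to loop             = inj₁ (suc (suc zero))
    to rewind           = inj₁ (suc (suc (suc zero)))
    to (block-letter i) = inj₂ (inj₁ i)
    to (rewind-put d)   = inj₂ (inj₂ (inj₁ d))
    to (head q)         = inj₂ (inj₂ (inj₂ (inj₁ q)))
    to (overwrite q d)  = inj₂ (inj₂ (inj₂ (inj₂ (inj₁ (q , d)))))
    to (fetch q)        = inj₂ (inj₂ (inj₂ (inj₂ (inj₂ (inj₁ q)))))
    to (put q d)        = inj₂ (inj₂ (inj₂ (inj₂ (inj₂ (inj₂ (q , d))))))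
    from : Sum → S
    from (inj₁ zero)                   = post₁
    from (inj₁ (suc zero))             = post₂
    from (inj₁ (suc (suc zero)))       = loop
    from (inj₁ (suc (suc (suc zero)))) = rewind
    from (inj₂ (inj₁ i))               = block-letter i
    from (inj₂ (inj₂ (inj₁ d)))        = rewind-put d
    from (inj₂ (inj₂ (inj₂ (inj₁ q)))) = head q
    from (inj₂ (inj₂ (inj₂ (inj₂ (inj₁ (q , d))))))        = overwrite q d
    from (inj₂ (inj₂ (inj₂ (inj₂ (inj₂ (inj₁ q))))))       = fetch q
    from (inj₂ (inj₂ (inj₂ (inj₂ (inj₂ (inj₂ (q , d))))))) = put q d
    from∘to : ∀ s → from (to s) ≡ s
    from∘to post₁            = refl
    from∘to post₂            = refl
    from∘to loop             = refl
    from∘to rewind           = refl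
    from∘to (block-letter i) = refl
    from∘to (rewind-put d)   = refl
    from∘to (head q)         = refl
    from∘to (overwrite q d)  = refl
    from∘to (fetch q)        = refl
    from∘to (put q d)        = refl

  open Compile instr post₁ hiding (base)
  open Machine op using (Conf; steps; _⟶[_]_)

  -- Opaque to keep the type checker from computing the size of the vocabulary.
  opaque
    EQ : Enumeration Q
    EQ = enum-Q enum-S

    EL : Enumeration (Label Q)
    EL = enum-Label EQ

  -- The sentence thus describes runs that end with the rejection of `M`.
  open Runs EQ EL op load₁ start (at (head reject) collect)

  -- Correctness of the simulation

  config : S → ℕ → ℕ → ℕ → Conf
  config s l r k = at s collect , l ∷ r ∷ k ∷ 0 ∷ []

  push-right : ∀ {s a s′} → instr s ≡ push rightˢ (digit a) s′ → ∀ {l as k} →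
               config s l (number as) k ⇒ config s′ l (number (a ∷ as)) k
  push-right is = push-run is

  push-left : ∀ {s a s′} → instr s ≡ push leftˢ (digit a) s′ → ∀ {as r k} →
              config s (number as) r k ⇒ config s′ (number (a ∷ as)) r k
  push-left is = push-run is

  pop-right : ∀ {s c} → instr s ≡ pop rightˢ c → ∀ a {l as k} →
              config s l (number (a ∷ as)) k ⇒ config (c (digit a)) l (number as) k
  pop-right is a = pop-run is (digit a)

  pop-left : ∀ {s c} → instr s ≡ pop leftˢ c → ∀ a {as r k} →
             config s (number (a ∷ as)) r k ⇒ config (c (digit a)) (number as) r k
  pop-left is a = pop-run is (digit a)

  -- Allows an empty stack to be popped as if a blank lay on it, as the infinite tape demands.
  number-blank : number (blank ∷ []) ≡ 0
  number-blank rewrite digit-blank = refl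

  encodeConfiguration : Configuration → Conf
  encodeConfiguration (q , tape ls a rs) = config (head q) (number ls) (number (a ∷ rs)) 0

  simulate-act : ∀ s ls rs q a m → instr s ≡ act (q , a , m) →
    config s (number ls) (number rs) 0 ⇒ encodeConfiguration (q , move m (tape ls a rs))
  simulate-act s []       rs q a left is = push-right {a = a} is {as = rs}
    ► ⇒-reflexive (cong (λ l → config (fetch q) l (number (a ∷ rs)) 0) (sym number-blank))
    ► pop-left {fetch q} refl blank {[]} ► push-right {put q (digit blank)} refl {as = a ∷ rs}
  simulate-act s (l ∷ ls) rs q a left is = push-right {a = a} is {as = rs}
    ► pop-left {fetch q} refl l {ls} ► push-right {put q (digit l)} refl {as = a ∷ rs}
  simulate-act s ls rs q a stay is = push-right {a = a} is {as = rs}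
  simulate-act s ls []       q a right is = push-left {a = a} is {ls}
    ► ⇒-reflexive (cong (λ r → config (head q) (number (a ∷ ls)) r 0) (sym number-blank))
  simulate-act s ls (r ∷ rs) q a right is = push-left {a = a} is {ls}

  simulate-step : ∀ c → encodeConfiguration c ⇒ encodeConfiguration (TuringMachine.step M c)
  simulate-step (accept , _) = ⇒-refl
  simulate-step (reject , _) = ⇒-refl
  simulate-step (running q , tape ls a rs) = pop-right {head (running q)} refl a {as = rs}
    ► simulate-act (overwrite q (digit a)) ls rs (proj₁ (δᴹ q a)) (proj₁ (proj₂ (δᴹ q a))) (proj₂ (proj₂ (δᴹ q a)))
        (cong (λ a → act (δᴹ q a)) (symbol∘digit a))

  simulate-run : ∀ n c → encodeConfiguration c ⇒ encodeConfiguration (run n c)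
  simulate-run zero    c = ⇒-refl
  simulate-run (suc n) c = simulate-step c ► simulate-run n (TuringMachine.step M c)

  inputs : List Letter → ℕ
  inputs w = number (map input w)

  lookup-drop : ∀ {A : Set} (xs : List A) i → List.lookup xs i ∷ List.drop (suc (toℕ i)) xs ≡ List.drop (toℕ i) xs
  lookup-drop (x ∷ xs) zero    = refl
  lookup-drop (x ∷ xs) (suc i) = lookup-drop xs i

  -- The letters after position `i` are already written. The recursion is on `n` because `inject₁ i`
  -- is not structurally smaller than `suc i`.
  emit-letters : ∀ n i {l k} w → toℕ i ≡ n →
                 config (block-letter i) l (inputs (List.drop (suc (toℕ i)) block ++ w)) k ⇒ config loop l (inputs (block ++ w)) k
  emit-letters n i {l} {k} w eq = push-right {block-letter i} refl {as = map input (List.drop (suc (toℕ i)) block ++ w)}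
    ► ⇒-reflexive (cong (λ v → config (next-letter i) l (inputs (v ++ w)) k) (lookup-drop block i))
    ► rest n i eq
    where
    rest : ∀ n i → toℕ i ≡ n → config (next-letter i) l (inputs (List.drop (toℕ i) block ++ w)) k ⇒
                               config loop l (inputs (block ++ w)) k
    rest _       zero    _  = ⇒-refl
    rest (suc n) (suc i) eq =
      ⇒-reflexive (cong (λ j → config (block-letter (inject₁ i)) l (inputs (List.drop (suc j) block ++ w)) k) (sym (toℕ-inject₁ i)))
      ► emit-letters n (inject₁ i) w (trans (toℕ-inject₁ i) (suc-injective eq))

  emit-blocks : ∀ k n {l} → config loop l (inputs (suffix n)) k ⇒ config rewind l (inputs (suffix (k + n))) 0
  emit-blocks zero    n     = 1 , refl
  emit-blocks (suc k) n {l} = (1 , refl) ► emit-letters 11 (fromℕ 11) (suffix n) refl ► emit-blocks k (suc n)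
    ► ⇒-reflexive (cong (λ j → config rewind l (inputs (suffix j)) 0) (ℕ.+-suc k n))

  rewind-tape : ∀ w u → config rewind (inputs w) (inputs u) 0 ⇒
                        config (head (TuringMachine.start M)) 0 (inputs (w List.ʳ++ u)) 0
  rewind-tape []      u =
    ⇒-reflexive (cong (λ l → config rewind l (inputs u) 0) (sym number-blank))
    ► pop-left {rewind} refl blank {[]}
    ► ⇒-reflexive (cong (λ d → config (rewound d) 0 (inputs u) 0) digit-blank)
  rewind-tape (a ∷ w) u =
    pop-left {rewind} refl (input a) {map input w}
    ► ⇒-reflexive (cong (λ d → config (rewound d) (inputs w) (inputs u) 0) (digit-input a))
    ► push-run {rewind-put (suc (index EY (input a)))} refl
    ► ⇒-reflexive (cong (λ d → config rewind (inputs w) (toℕ d + inputs u * base) 0) (sym (digit-input a)))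
    ► rewind-tape w (a ∷ u)

  encode-initial : ∀ w → config (head (TuringMachine.start M)) 0 (inputs w) 0 ≡
                         encodeConfiguration (TuringMachine.start M , initialTape w)
  encode-initial []      = cong (λ r → config (head (TuringMachine.start M)) 0 r 0) (sym number-blank)
  encode-initial (a ∷ w) = refl

  -- Not circular, as `prefix` does not depend on the number of levels. It is reversed so that its
  -- last letter lies on top and is transferred first.
  N : ℕ
  N = inputs (reverse prefix)

  -- The loading loop is run through at least once, so it loads positive numbers only.
  N≢0 : N ≢ 0
  N≢0 eq = nonzero (reverse prefix) (λ rev≡[] → case trans (sym (reverse-involutive prefix)) (cong reverse rev≡[]) of λ ()) eq
    where
    nonzero : ∀ w → w ≢ [] → inputs w ≢ 0
    nonzero []      w≢ eq = w≢ refl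
    nonzero (a ∷ w) w≢ eq rewrite digit-input a = case eq of λ ()

  c₀ : Conf
  c₀ = start , loaded N

  prepare : c₀ ⇒ encodeConfiguration (TuringMachine.start M , initialTape (encode (φ N)))
  prepare = (1 , refl)
    ► push-right {post₁} refl {as = []} ► push-right {post₂} refl {as = map input (`𝑥 ∷ [])}
    ► emit-blocks N 0 ► rewind-tape (reverse prefix) (suffix (N + 0))
    ► ⇒-reflexive (trans (cong (λ w → config (head (TuringMachine.start M)) 0 (inputs w) 0) unwind) (encode-initial (encode (φ N))))
    where
    open ≡-Reasoning
    unwind : reverse prefix List.ʳ++ suffix (N + 0) ≡ encode (φ N)
    unwind = begin
      reverse prefix List.ʳ++ suffix (N + 0)          ≡⟨ ʳ++-defn (reverse prefix) ⟩
      reverse (reverse prefix) ++ suffix (N + 0)      ≡⟨ cong₂ (λ w n → w ++ suffix n) (reverse-involutive prefix) (+-identityʳ N) ⟩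
      prefix ++ suffix N                              ≡⟨ encode-φ N ⟨
      encode (φ N)                                    ∎

  reaches : ∀ {q} → HaltsAs q (encode (φ N)) → ∃[ n ] proj₁ (iterate n c₀) ≡ at (head q) collect
  reaches (n , refl) with prepare ► simulate-run n (TuringMachine.start M , initialTape (encode (φ N)))
  ... | k , eq = k , trans (cong proj₁ eq) (state-of (run n _))
    where
    state-of : ∀ c → proj₁ (encodeConfiguration c) ≡ at (head (proj₁ c)) collect
    state-of (_ , tape _ _ _) = refl

  -- Satisfiability and rejection

  rejecting⇒satisfiable : Rejects (encode (φ N)) → FinitelySatisfiable (φ N)
  rejecting⇒satisfiable rejects = go N N≢0 (reaches rejects)
    where
    go : ∀ N → N ≢ 0 → (∃[ n ] proj₁ (iterate n (start , loaded N)) ≡ at (head reject) collect) →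
         FinitelySatisfiable (φ N)
    go zero    N≢0 _ = contradiction refl N≢0
    -- The model's last instant is `n + suc N * 2`: loading takes `suc N * 2` steps and the run from
    -- `start` to the rejection takes `n`.
    go (suc N) _ (n , eq) = 𝒜 , satisfied (ℕ.m≤n+m (suc N * 2) n) (cong proj₁ (load-complete N)) finished
      where
      open Completeness (branches N) (suc N) (n + suc N * 2) using (𝒜; satisfied)
      started : Late (proj₁ (steps (branches N) (suc N * 2) (load₁ , loaded 0)))
      started = subst Late (sym (cong proj₁ (load-complete N))) start
      finished : proj₁ (steps (branches N) (n + suc N * 2) (load₁ , loaded 0)) ≡ at (head reject) collect
      finished = trans (cong proj₁ (trans (steps-determined n started) (cong (iterate n) (load-complete N)))) eq

  satisfiable⇒rejecting-run : FinitelySatisfiable (φ N) → ∃[ n ] proj₁ (iterate n c₀) ≡ at (head reject) collect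
  satisfiable⇒rejecting-run (𝒜 , model) with Soundness.run-exists 𝒜 {N} model
  ... | d , e , path , started , n , path′ , finished with load-sound N 0 path started
  ...   | refl = n , (begin
    proj₁ (iterate n c₀)                   ≡⟨ cong (λ j → proj₁ (iterate n (start , loaded j))) (+-identityʳ N) ⟨
    proj₁ (iterate n (start , loaded (N + 0))) ≡⟨ cong proj₁ (path-determined (start , loaded (N + 0)) start path′) ⟨
    proj₁ e                                ≡⟨ finished ⟩
    at (head reject) collect               ∎)
    where open ≡-Reasoning

  still-halted : ∀ {s n k} → instr s ≡ halt → n ≤ k →
                 proj₁ (iterate n c₀) ≡ at s collect → proj₁ (iterate k c₀) ≡ at s collect
  still-halted {s} {n} {k} is n≤k eq =
    trans (cong proj₁ (trans (cong (λ j → iterate j c₀) (sym (ℕ.m+[n∸m]≡n n≤k))) (iterate-+ n (k ∸ n) c₀)))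
      (halted (k ∸ n) is eq)

  -- Both halting states are permanent, so at the later of the two times the run would be in both.
  accepting-run⇒no-rejecting-run : ∀ n k → proj₁ (iterate n c₀) ≡ at (head accept) collect →
                                   proj₁ (iterate k c₀) ≢ at (head reject) collect
  accepting-run⇒no-rejecting-run n k accepting rejecting with ℕ.≤-total n k
  ... | inj₁ n≤k = case trans (sym (still-halted {head accept} refl n≤k accepting)) rejecting of λ ()
  ... | inj₂ k≤n = case trans (sym (still-halted {head reject} refl k≤n rejecting)) accepting of λ ()

  -- Acceptance would give a model, hence a rejecting run of a machine that halts accepting.
  -- Rejection would give a model, hence acceptance by the assumed correctness of `M`.
  undecided : ¬ Decides M encode FinitelySatisfiable
  undecided decides = not-accepted (accepted (proj₁ (decides (φ N))))
    where
    not-accepted : ¬ Accepts (encode (φ N))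
    not-accepted accepts =
      let (n , accepting) = reaches accepts
          (k , rejecting) = satisfiable⇒rejecting-run (Equivalence.to (proj₂ (decides (φ N))) accepts)
      in accepting-run⇒no-rejecting-run n k accepting rejecting
    accepted : Accepts (encode (φ N)) ⊎ Rejects (encode (φ N)) → Accepts (encode (φ N))
    accepted (inj₁ accepts) = accepts
    accepted (inj₂ rejects) = Equivalence.from (proj₂ (decides (φ N))) (rejecting⇒satisfiable rejects)

theorem1 : Undecidable encode FinitelySatisfiable
theorem1 (M , decides) = Simulation.undecided M decides
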